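{- Let $\vec{A}\in\mathbb{R}^{m\times n}$, let $\alpha\in(0,1)$, and let $p$ be arbitrary. Let $f(s)=\max_{S\subseteq[n]:|S|\le s}\mathrm{disc}_{p,\alpha}(\vec{A}|_S)$. Then $$\mathrm{disc}_{p,1}(\vec{A})\le\sum_{i=0}^{\infty}f((1-\alpha)^i n),$$ and, therefore, $$\mathrm{herdisc}_{p,1}(\vec{A})\le\sum_{i=0}^{\infty}f((1-\alpha)^i n).$$
   Context: Here $\|\cdot\|_p$ is the $\ell_p$ norm and $[n]=\{1,\dots,n\}$. For a real matrix $\vec{B}$ with $k$ columns, $\mathrm{disc}_{p,\alpha}(\vec{B})=\min\{\|\vec{B}\vec{x}\|_p:\vec{x}\in\{0,1,-1\}^k,\ \|\vec{x}\|_1\ge\alpha k\}$ (which is $0$ if $k=0$); $\mathrm{disc}_{p,1}$ is the case $\alpha=1$. For $S\subseteq[n]$, $\vec{A}|_S$ is the submatrix of $\vec{A}$ consisting of the columns indexed by $S$, with duplicated rows removed. Finally $\mathrm{herdisc}_{p,\alpha}(\vec{A})=\max_{S\subseteq[n]}\mathrm{disc}_{p,\alpha}(\vec{A}|_S)$, and $\mathrm{herdisc}_{p,1}$ is the case $\alpha=1$.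
   Formalization: For finite p, duplicated rows of A|_S are kept, since removing them makes both bounds false (p=1, α=1/2, A=(1,1)^T: 2 > 1); for p=∞ both conventions are covered. "p arbitrary" means 1 ≤ p ≤ ∞. -}

module Defs where

open import Algebra.Bundles using (CommutativeRing; Semiring)
open import Algebra.Structures using (IsCommutativeRing)
open import Data.Fin.Subset using (Subset; inside; outside; ∣_∣; ⊥)
open import Data.List.Base as List using (List; []; _∷_; cartesianProductWith; deduplicate; filter; length)
open import Data.Nat.Base as ℕ using (ℕ; zero; suc)
open import Data.Product.Base using (∃; ∃₂; _×_)
open import Data.Sum.Base using (_⊎_)
open import Data.Vec.Base as Vec using (Vec; []; _∷_; fromList; replicate; toList; zipWith)
open import Data.Vec.Relation.Binary.Pointwise.Inductive using (Pointwise; decidable)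
open import Level using (0ℓ)
open import Relation.Binary.Bundles using (DecTotalOrder)
open import Relation.Binary.Structures using (IsDecTotalOrder)
open import Relation.Nullary.Negation.Core using (¬_)
import Algebra.Construct.NaturalChoice.Max as Max
import Algebra.Definitions.RawSemiring as RawSemiringDefinitions
import Data.List.Extrema as Extrema
import Relation.Binary.Properties.DecTotalOrder as DecTotalOrderProperties

-- The real numbers, axiomatised up to isomorphism as a (classical) complete
-- ordered field.  Decidability of the order, totality of `_⁻¹` and `sup`
-- (unspecified at 0# and at empty or unbounded sets), and the witness given by
-- `archimedean` are all available classically.
record RealNumbers : Set₁ where
  infix  4 _≈_ _≤_
  infixl 6 _+_
  infixl 7 _*_
  infix  8 -_
  infix  9 _⁻¹
  field
    Carrier : Set
    _≈_ _≤_ : Carrier → Carrier → Set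
    _+_ _*_ : Carrier → Carrier → Carrier
    -_ _⁻¹  : Carrier → Carrier
    0# 1#   : Carrier

    isCommutativeRing : IsCommutativeRing _≈_ _+_ _*_ -_ 0# 1#
    0≉1               : ¬ (0# ≈ 1#)
    ⁻¹-inverse        : ∀ x → ¬ (x ≈ 0#) → x * x ⁻¹ ≈ 1#

    isDecTotalOrder   : IsDecTotalOrder _≈_ _≤_
    +-monoʳ-≤         : ∀ x {y z} → y ≤ z → x + y ≤ x + z
    *-nonneg          : ∀ {x y} → 0# ≤ x → 0# ≤ y → 0# ≤ x * y

  commutativeRing : CommutativeRing 0ℓ 0ℓ
  commutativeRing = record { isCommutativeRing = isCommutativeRing }

  decTotalOrder : DecTotalOrder 0ℓ 0ℓ 0ℓ
  decTotalOrder = record { isDecTotalOrder = isDecTotalOrder }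

  open CommutativeRing commutativeRing public using (_-_; semiring)
  open DecTotalOrder decTotalOrder public using (_≤?_; _≟_; totalOrder)
  open DecTotalOrderProperties decTotalOrder public using (_<_)
  open RawSemiringDefinitions (Semiring.rawSemiring semiring) public using (_^_) renaming (_×_ to _·_)

  fromℕ : ℕ → Carrier
  fromℕ n = n · 1#

  UpperBound : (Carrier → Set) → Carrier → Set
  UpperBound P u = ∀ x → P x → x ≤ u

  IsSupremum : (Carrier → Set) → Carrier → Set
  IsSupremum P s = UpperBound P s × (∀ u → UpperBound P u → s ≤ u)

  field
    sup         : (Carrier → Set) → Carrier
    complete    : ∀ P → ∃ P → ∃ (UpperBound P) → IsSupremum P (sup P)
    archimedean : ∀ x → ∃ λ n → x ≤ fromℕ n


module Discrepancy (ℝ : RealNumbers) where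

  open RealNumbers ℝ public
  open Max totalOrder using (_⊔_)
  open Extrema totalOrder using (min; max)

  ------------------------------------------------------------------------
  -- Real powers and series

  -- x ^ʳ e is the real power for x ≥ 0 and e > 0, as the supremum of the y ≥ 0
  -- with y ≤ x^(a/b) for a rational a/b on the side of e where x^(a/b) ≤ x^e:
  -- a/b ≤ e if x ≥ 1, and a/b ≥ e if x ≤ 1.
  infixr 8 _^ʳ_
  _^ʳ_ : Carrier → Carrier → Carrier
  x ^ʳ e = sup λ y → 0# ≤ y × ∃₂ λ a b →
    1 ℕ.≤ b ×
    ((1# ≤ x × fromℕ a ≤ e * fromℕ b) ⊎ (x ≤ 1# × e * fromℕ b ≤ fromℕ a)) ×
    y ^ b ≤ x ^ a

  abs : Carrier → Carrier
  abs x = x ⊔ (- x)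

  partialSum : (ℕ → Carrier) → ℕ → Carrier
  partialSum a zero    = 0#
  partialSum a (suc n) = partialSum a n + a n

  HasSum : (ℕ → Carrier) → Carrier → Set
  HasSum a s = ∀ ε → 0# < ε → ∃ λ N → ∀ n → N ℕ.≤ n → abs (partialSum a n - s) < ε

  ------------------------------------------------------------------------
  -- Vectors, norms and matrices

  sum : ∀ {n} → Vec Carrier n → Carrier
  sum = Vec.foldr′ _+_ 0#

  data Exponent : Set where
    finite : (p : Carrier) → 1# ≤ p → Exponent
    ∞      : Exponent

  norm : Exponent → ∀ {n} → Vec Carrier n → Carrier
  norm (finite p _) v = sum (Vec.map (λ x → abs x ^ʳ p) v) ^ʳ (p ⁻¹)
  norm ∞            v = Vec.foldr′ _⊔_ 0# (Vec.map abs v)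

  norm₁ : ∀ {n} → Vec Carrier n → Carrier
  norm₁ v = sum (Vec.map abs v)

  -- A matrix is the vector of its rows.
  Matrix : ℕ → ℕ → Set
  Matrix m n = Vec (Vec Carrier n) m

  infixl 7 _*ᵥ_
  _*ᵥ_ : ∀ {m n} → Matrix m n → Vec Carrier n → Vec Carrier m
  A *ᵥ x = Vec.map (λ row → sum (zipWith _*_ row x)) A

  select : ∀ {n} (S : Subset n) → Vec Carrier n → Vec Carrier ∣ S ∣
  select []            []       = []
  select (inside  ∷ S) (x ∷ xs) = x ∷ select S xs
  select (outside ∷ S) (x ∷ xs) = select S xs

  columns : ∀ {m n} → Matrix m n → (S : Subset n) → Matrix m ∣ S ∣
  columns A S = Vec.map (select S) A

  dedup : ∀ {n} → List (Vec Carrier n) → List (Vec Carrier n)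
  dedup = deduplicate (decidable _≟_)

  distinctRows : ∀ {m n} (A : Matrix m n) → Matrix (length (dedup (toList A))) n
  distinctRows A = fromList (dedup (toList A))

  ------------------------------------------------------------------------
  -- Discrepancy

  allVecs : ∀ {X : Set} → List X → ∀ n → List (Vec X n)
  allVecs xs zero    = [] ∷ []
  allVecs xs (suc n) = cartesianProductWith _∷_ xs (allVecs xs n)

  colourings : ∀ k → List (Vec Carrier k)
  colourings = allVecs (0# ∷ 1# ∷ - 1# ∷ [])

  subsets : ∀ n → List (Subset n)
  subsets = allVecs (inside ∷ outside ∷ [])

  -- `min` takes the minimum of its first argument and of the list; the all-ones
  -- colouring is admissible whenever α ≤ 1, so it adds nothing.
  disc : Exponent → Carrier → ∀ {m k} → Matrix m k → Carrier
  disc p α {k = k} B = min (norm p (B *ᵥ replicate k 1#))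
    (List.map (λ x → norm p (B *ᵥ x))
      (filter (λ x → α * fromℕ k ≤? norm₁ x) (colourings k)))

  -- How A|_S treats duplicated rows.  Removing them changes no ℓ∞ norm, but it
  -- can decrease an ℓₚ norm with p < ∞, and then neither bound of the lemma
  -- holds: with p = 1 and α = 1/2, the column (1,1)ᵀ has disc_{1,1} = 2 while
  -- the series is 1, and the matrix with rows (10,0), (10,1), (10,2) has
  -- herdisc_{1,1} ≥ 27 while the series is 10 + 10.  So duplicates may be
  -- removed for p = ∞ only, and may be kept for every p.
  data Duplicates : Exponent → Set where
    kept    : ∀ {p} → Duplicates p
    removed : Duplicates ∞

  -- disc_{p,α}(A|_S)
  discOn : ∀ {p} → Duplicates p → Carrier → ∀ {m n} → Matrix m n → Subset n → Carrier
  discOn {p} kept    α A S = disc p α (columns A S)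
  discOn     removed α A S = disc ∞ α (distinctRows (columns A S))

  -- As for `min`, the first argument of `max` is a member of the set: the empty
  -- subset, which has size at most s whenever s ≥ 0.
  herdisc : ∀ {p} → Duplicates p → Carrier → ∀ {m n} → Matrix m n → Carrier
  herdisc d α {n = n} A = max (discOn d α A ⊥) (List.map (discOn d α A) (subsets n))

  maxDiscUpTo : ∀ {p} → Duplicates p → Carrier → ∀ {m n} → Matrix m n → Carrier → Carrier
  maxDiscUpTo d α {n = n} A s = max (discOn d α A ⊥)
    (List.map (discOn d α A) (filter (λ S → fromℕ ∣ S ∣ ≤? s) (subsets n)))

{-# OPTIONS --safe #-}
module Submission where

-- Colour all columns by repeated partial colouring: an optimal colouring of A|_S
-- with at least α|S| nonzero entries leaves a set S₁ of at most (1 - α)|S| columns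
-- uncoloured, and by the triangle inequality the discrepancies of the rounds add up.
-- The set is empty once (1 - α)^i n < 1, and from there on the series vanishes too.
--
-- The triangle inequality for a real exponent p is Minkowski's.  A power x ^ʳ e is
-- compared with the n-th roots of x ^ ⌊e n⌋ up to factors 1 + O(1/n), which carries
-- multiplicativity and Bernoulli's inequality 1 + p (t - 1) ≤ t ^ʳ p (from the
-- arithmetic-geometric mean inequality) over to real exponents.  Bernoulli's
-- inequality is the tangent of t ^ʳ p at 1, and by homogeneity it gives convexity.

-- The definition of `x ^ʳ e` offers no exponential or logarithm to work with, and it approximates e
-- from different sides for bases below and above 1, so a product of bases on opposite sides of 1
-- cannot be read off from it. The approximants with exponent ⌊e n⌋ use one rational for all bases,
-- which makes multiplicativity exact before the limit. Errors O(1/n) are kept as explicit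
-- constants, so that passing to the limit is an appeal to the Archimedean property.
--
-- The hereditary bound is not deduced by applying the first bound to submatrices, which would give
-- series in |S| instead of n. The induction starts from an arbitrary S and carries a real number s
-- with |S| ≤ s; starting at s = n gives the same series for every S, and no size has to be rounded
-- to an integer. As the terms vanish from some N on, the partial sum up to N serves as the sum of
-- the series.

open import Defs
open import Algebra.Bundles using (CommutativeRing)
open import Algebra.Construct.NaturalChoice.Max using (maxOperator)
open import Algebra.Solver.Ring.AlmostCommutativeRing using (fromCommutativeRing; _-Raw-AlmostCommutative⟶_)
open import Data.Bool.Base using (true; false)
open import Data.Fin.Base using (zero; suc)
open import Data.Fin.Subset using (Subset; inside; outside; ∣_∣; ⊥; ⊤)
open import Data.Fin.Subset.Properties using (∣p∣≤n; ∣⊥∣≡0)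
open import Data.Integer.Base as ℤ using (ℤ; +_; -[1+_]; _⊖_)
open import Data.List.Base as List using (List; []; _∷_)
open import Data.List.Membership.Propositional using (_∈_; lose)
open import Data.List.Membership.Propositional.Properties
  using (∈-map⁺; ∈-map⁻; ∈-filter⁺; ∈-filter⁻; ∈-cartesianProductWith⁺; ∈-cartesianProductWith⁻)
open import Data.List.Relation.Unary.Any using (here; there)
open import Data.Maybe.Base using (Maybe; just; nothing)
open import Data.Nat.Base as ℕ using (ℕ; zero; suc)
open import Data.Product.Base using (∃; ∃₂; _×_; _,_; proj₁; proj₂; Σ-syntax)
open import Data.Sum.Base using (_⊎_; inj₁; inj₂)
open import Data.Vec.Base as Vec using (Vec; []; _∷_; lookup; replicate; zipWith; toList)
open import Data.Vec.Relation.Binary.Pointwise.Inductive as Pointwise using (Pointwise; []; _∷_)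
open import Data.Vec.Relation.Unary.All as All using (All; []; _∷_)
open import Relation.Binary.Bundles using (DecTotalOrder)
open import Relation.Binary.PropositionalEquality as ≡ using (_≡_)
open import Relation.Nullary using (¬_; yes; no; contradiction)
import Algebra.Construct.NaturalChoice.MaxOp as MaxOp
import Algebra.Properties.CommutativeSemiring.Exp as Exp
import Algebra.Properties.Ring as RingProperties
import Algebra.Properties.Semiring.Mult as Mult
import Algebra.Properties.Semiring.Mult.TCOptimised as MultTC
import Algebra.Solver.Ring as RingSolver
import Data.Integer.Properties as ℤ
import Data.List.Extrema as Extrema
import Data.List.Relation.Unary.All as ListAll
import Data.List.Relation.Unary.All.Properties as ListAll
import Data.Nat.Properties as ℕ
import Data.Vec.Properties as Vec
import Data.Vec.Relation.Unary.All.Properties as All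
import Relation.Binary.Properties.DecTotalOrder as DecTotalOrderProperties
import Relation.Binary.Reasoning.PartialOrder as PartialOrderReasoning
import Relation.Binary.Reasoning.Setoid as SetoidReasoning

-- Ring solver with integer coefficients

module IntegerCoefficients {c ℓ} (R : CommutativeRing c ℓ) where
  open CommutativeRing R
  open MultTC semiring using (×-homo-+; ×1-homo-*) renaming (_×_ to _·_)
  open RingProperties ring using (-‿+-comm; -0#≈0#; -‿involutive; -‿distribˡ-*; -‿distribʳ-*)
  open SetoidReasoning setoid

  private
    -- Normalisation has to recognise vanishing coefficients. Integers have decidable equality,
    -- which R need not have, and they contain the -1 that subtraction requires. The multiple
    -- `1 · 1#` computes to `1#`, so that the coefficient 1 denotes exactly the unit in solved
    -- goals.
    ⟦_⟧ : ℤ → Carrier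
    ⟦ + n ⟧ = n · 1#
    ⟦ -[1+ n ] ⟧ = - (suc n · 1#)

    neg-homo : ∀ i → ⟦ ℤ.- i ⟧ ≈ - ⟦ i ⟧
    neg-homo (+ zero) = sym -0#≈0#
    neg-homo (+ suc n) = refl
    neg-homo -[1+ n ] = sym (-‿involutive _)

    suc-homo : ∀ n → suc n · 1# ≈ 1# + n · 1#
    suc-homo n = ×-homo-+ 1# 1 n

    ⊖-homo : ∀ m n → ⟦ m ⊖ n ⟧ ≈ m · 1# - n · 1#
    ⊖-homo m zero = sym (trans (+-congˡ -0#≈0#) (+-identityʳ _))
    ⊖-homo zero (suc n) = sym (+-identityˡ _)
    ⊖-homo (suc m) (suc n) = begin
      ⟦ suc m ⊖ suc n ⟧                    ≡⟨ ≡.cong ⟦_⟧ (ℤ.[1+m]⊖[1+n]≡m⊖n m n) ⟩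
      ⟦ m ⊖ n ⟧                            ≈⟨ ⊖-homo m n ⟩
      m · 1# - n · 1#                      ≈⟨ +-identityˡ _ ⟨
      0# + (m · 1# - n · 1#)               ≈⟨ +-congʳ (-‿inverseʳ 1#) ⟨
      1# - 1# + (m · 1# - n · 1#)          ≈⟨ +-assoc _ _ _ ⟩
      1# + (- 1# + (m · 1# - n · 1#))      ≈⟨ +-congˡ (+-assoc _ _ _) ⟨
      1# + (- 1# + m · 1# - n · 1#)        ≈⟨ +-congˡ (+-congʳ (+-comm _ _)) ⟩
      1# + (m · 1# - 1# - n · 1#)          ≈⟨ +-congˡ (+-assoc _ _ _) ⟩
      1# + (m · 1# + (- 1# - n · 1#))      ≈⟨ +-assoc _ _ _ ⟨
      1# + m · 1# + (- 1# - n · 1#)        ≈⟨ +-cong (sym (suc-homo m)) (-‿+-comm _ _) ⟩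
      suc m · 1# - (1# + n · 1#)           ≈⟨ +-congˡ (-‿cong (suc-homo n)) ⟨
      suc m · 1# - suc n · 1#              ∎

    +-homo : ∀ i j → ⟦ i ℤ.+ j ⟧ ≈ ⟦ i ⟧ + ⟦ j ⟧
    +-homo (+ m) (+ n) = ×-homo-+ 1# m n
    +-homo (+ m) -[1+ n ] = ⊖-homo m (suc n)
    +-homo -[1+ m ] (+ n) = trans (⊖-homo n (suc m)) (+-comm _ _)
    +-homo -[1+ m ] -[1+ n ] = begin
      - (suc (suc (m ℕ.+ n)) · 1#)      ≡⟨ ≡.cong (λ k → - (suc k · 1#)) (≡.sym (ℕ.+-suc m n)) ⟩
      - ((suc m ℕ.+ suc n) · 1#)        ≈⟨ -‿cong (×-homo-+ 1# (suc m) (suc n)) ⟩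
      - (suc m · 1# + suc n · 1#)       ≈⟨ -‿+-comm _ _ ⟨
      - (suc m · 1#) - suc n · 1#       ∎

    pos-*-homo : ∀ m n → ⟦ + m ℤ.* + n ⟧ ≈ (m · 1#) * (n · 1#)
    pos-*-homo m n = trans (reflexive (≡.cong ⟦_⟧ (≡.sym (ℤ.pos-* m n)))) (×1-homo-* m n)

    *-homo : ∀ i j → ⟦ i ℤ.* j ⟧ ≈ ⟦ i ⟧ * ⟦ j ⟧
    *-homo (+ m) (+ n) = pos-*-homo m n
    *-homo (+ m) -[1+ n ] = begin
      ⟦ + m ℤ.* -[1+ n ] ⟧         ≡⟨ ≡.cong ⟦_⟧ (ℤ.neg-distribʳ-* (+ m) (+ suc n)) ⟨
      ⟦ ℤ.- (+ m ℤ.* + suc n) ⟧    ≈⟨ neg-homo (+ m ℤ.* + suc n) ⟩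
      - ⟦ + m ℤ.* + suc n ⟧        ≈⟨ -‿cong (pos-*-homo m (suc n)) ⟩
      - (m · 1# * (suc n · 1#))    ≈⟨ -‿distribʳ-* _ _ ⟩
      m · 1# * - (suc n · 1#)      ∎
    *-homo -[1+ m ] (+ n) = begin
      ⟦ -[1+ m ] ℤ.* + n ⟧         ≡⟨ ≡.cong ⟦_⟧ (ℤ.neg-distribˡ-* (+ suc m) (+ n)) ⟨
      ⟦ ℤ.- (+ suc m ℤ.* + n) ⟧    ≈⟨ neg-homo (+ suc m ℤ.* + n) ⟩
      - ⟦ + suc m ℤ.* + n ⟧        ≈⟨ -‿cong (pos-*-homo (suc m) n) ⟩
      - (suc m · 1# * (n · 1#))    ≈⟨ -‿distribˡ-* _ _ ⟩
      - (suc m · 1#) * (n · 1#)    ∎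
    *-homo -[1+ m ] -[1+ n ] = begin
      ⟦ + suc m ℤ.* + suc n ⟧            ≈⟨ pos-*-homo (suc m) (suc n) ⟩
      suc m · 1# * (suc n · 1#)          ≈⟨ -‿involutive _ ⟨
      - - (suc m · 1# * (suc n · 1#))    ≈⟨ -‿cong (-‿distribʳ-* _ _) ⟩
      - (suc m · 1# * - (suc n · 1#))    ≈⟨ -‿distribˡ-* _ _ ⟩
      - (suc m · 1#) * - (suc n · 1#)    ∎

    morphism : ℤ.+-*-rawRing -Raw-AlmostCommutative⟶ fromCommutativeRing R
    morphism = record
      { ⟦_⟧ = ⟦_⟧ ; +-homo = +-homo ; *-homo = *-homo ; -‿homo = neg-homo ; 0-homo = refl ; 1-homo = refl }

    _coeff≟_ : ∀ i j → Maybe (⟦ i ⟧ ≈ ⟦ j ⟧)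
    i coeff≟ j with i ℤ.≟ j
    ... | yes ≡.refl = just refl
    ... | no _       = nothing

  open RingSolver ℤ.+-*-rawRing (fromCommutativeRing R) morphism _coeff≟_ public
    using (solve; con; _:=_; _:+_; _:*_; _:-_; :-_; Polynomial)

-- Ordered field arithmetic, natural powers and the Archimedean property

module OrderedField (ℝ : RealNumbers) where
  open RealNumbers ℝ public
  open CommutativeRing commutativeRing public
    using (refl; sym; trans; reflexive; setoid; +-cong; +-congˡ; +-congʳ; *-cong; *-congˡ; *-congʳ; -‿cong;
           +-identityˡ; +-identityʳ; *-identityˡ; *-identityʳ; +-comm; +-assoc; *-comm; *-assoc;
           zeroˡ; zeroʳ; distribʳ; -‿inverseʳ)
  open DecTotalOrder decTotalOrder public
    using (total; poset)
    renaming (refl to ≤-refl; reflexive to ≤-reflexive; trans to ≤-trans; antisym to ≤-antisym)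
  open DecTotalOrderProperties decTotalOrder public
    using (<⇒≱; ≰⇒>)
  open Exp (CommutativeRing.commutativeSemiring commutativeRing) public
    using (^-assocʳ; ^-distrib-*; ^-congˡ)
  open IntegerCoefficients commutativeRing public
  module ≤-Reasoning = PartialOrderReasoning poset
  module ≈-Reasoning = SetoidReasoning setoid

  :1 : ∀ {n} → Polynomial n
  :1 = con (+ 1)

  :0 : ∀ {n} → Polynomial n
  :0 = con (+ 0)

  <⇒≤ : ∀ {x y} → x < y → x ≤ y
  <⇒≤ = proj₁

  ≤-resp : ∀ {x x′ y y′} → x ≈ x′ → y ≈ y′ → x ≤ y → x′ ≤ y′
  ≤-resp x≈x′ y≈y′ x≤y = ≤-trans (≤-reflexive (sym x≈x′)) (≤-trans x≤y (≤-reflexive y≈y′))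

  +-mono-≤ : ∀ {x x′ y y′} → x ≤ x′ → y ≤ y′ → x + y ≤ x′ + y′
  +-mono-≤ {x} {x′} {y} {y′} x≤x′ y≤y′ = ≤-trans (+-monoʳ-≤ x y≤y′)
    (≤-resp (+-comm y′ x) (+-comm y′ x′) (+-monoʳ-≤ y′ x≤x′))

  +-monoˡ-≤ : ∀ z {x y} → x ≤ y → x + z ≤ y + z
  +-monoˡ-≤ z x≤y = +-mono-≤ x≤y ≤-refl

  +-nonneg : ∀ {x y} → 0# ≤ x → 0# ≤ y → 0# ≤ x + y
  +-nonneg 0≤x 0≤y = ≤-resp (+-identityʳ 0#) refl (+-mono-≤ 0≤x 0≤y)

  ≤-by : ∀ {x y} d → 0# ≤ d → x + d ≈ y → x ≤ y
  ≤-by {x} d 0≤d x+d≈y = ≤-resp (+-identityʳ x) x+d≈y (+-monoʳ-≤ x 0≤d)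

  x≤y⇒0≤y-x : ∀ {x y} → x ≤ y → 0# ≤ y - x
  x≤y⇒0≤y-x {x} x≤y = ≤-resp (-‿inverseʳ x) refl (+-monoˡ-≤ (- x) x≤y)

  0≤y-x⇒x≤y : ∀ {x y} → 0# ≤ y - x → x ≤ y
  0≤y-x⇒x≤y {x} {y} 0≤y-x = ≤-by (y - x) 0≤y-x (solve 2 (λ x y → x :+ (y :- x) := y) refl x y)

  neg-antimono-≤ : ∀ {x y} → x ≤ y → - y ≤ - x
  neg-antimono-≤ {x} {y} x≤y =
    ≤-by (y - x) (x≤y⇒0≤y-x x≤y) (solve 2 (λ x y → :- y :+ (y :- x) := :- x) refl x y)

  *-monoˡ-≤ : ∀ {x y z} → 0# ≤ x → y ≤ z → x * y ≤ x * z
  *-monoˡ-≤ {x} {y} {z} 0≤x y≤z = ≤-by (x * (z - y)) (*-nonneg 0≤x (x≤y⇒0≤y-x y≤z))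
    (solve 3 (λ x y z → x :* y :+ x :* (z :- y) := x :* z) refl x y z)

  *-monoʳ-≤ : ∀ {x y z} → 0# ≤ x → y ≤ z → y * x ≤ z * x
  *-monoʳ-≤ 0≤x y≤z = ≤-resp (*-comm _ _) (*-comm _ _) (*-monoˡ-≤ 0≤x y≤z)

  *-mono-≤ : ∀ {x x′ y y′} → 0# ≤ x → 0# ≤ y → x ≤ x′ → y ≤ y′ → x * y ≤ x′ * y′
  *-mono-≤ 0≤x 0≤y x≤x′ y≤y′ = ≤-trans (*-monoˡ-≤ 0≤x y≤y′) (*-monoʳ-≤ (≤-trans 0≤y y≤y′) x≤x′)

  0≤x² : ∀ x → 0# ≤ x * x
  0≤x² x with total 0# x
  ... | inj₁ 0≤x = *-nonneg 0≤x 0≤x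
  ... | inj₂ x≤0 = ≤-resp refl (solve 1 (λ x → (:0 :- x) :* (:0 :- x) := x :* x) refl x)
                     (*-nonneg (x≤y⇒0≤y-x x≤0) (x≤y⇒0≤y-x x≤0))

  0≤1 : 0# ≤ 1#
  0≤1 = ≤-resp refl (*-identityʳ 1#) (0≤x² 1#)

  0<1 : 0# < 1#
  0<1 = 0≤1 , 0≉1

  <-≤-trans : ∀ {x y z} → x < y → y ≤ z → x < z
  <-≤-trans x<y y≤z = ≰⇒> λ z≤x → <⇒≱ x<y (≤-trans y≤z z≤x)

  ≤-<-trans : ∀ {x y z} → x ≤ y → y < z → x < z
  ≤-<-trans x≤y y<z = ≰⇒> λ z≤x → <⇒≱ y<z (≤-trans z≤x x≤y)

  0<⇒≉0 : ∀ {x} → 0# < x → ¬ (x ≈ 0#)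
  0<⇒≉0 0<x x≈0 = proj₂ 0<x (sym x≈0)

  x*x⁻¹≈1 : ∀ {x} → 0# < x → x * x ⁻¹ ≈ 1#
  x*x⁻¹≈1 0<x = ⁻¹-inverse _ (0<⇒≉0 0<x)

  x⁻¹*x≈1 : ∀ {x} → 0# < x → x ⁻¹ * x ≈ 1#
  x⁻¹*x≈1 0<x = trans (*-comm _ _) (x*x⁻¹≈1 0<x)

  0<x⁻¹ : ∀ {x} → 0# < x → 0# < x ⁻¹
  0<x⁻¹ {x} 0<x = ≰⇒> λ x⁻¹≤0 → <⇒≱ 0<1
    (≤-resp (x*x⁻¹≈1 0<x) (zeroʳ x) (*-monoˡ-≤ (<⇒≤ 0<x) x⁻¹≤0))

  *-cancelˡ-≤ : ∀ {x y z} → 0# < x → x * y ≤ x * z → y ≤ z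
  *-cancelˡ-≤ {x} {y} {z} 0<x xy≤xz = ≤-resp (cancel y) (cancel z) (*-monoˡ-≤ (<⇒≤ (0<x⁻¹ 0<x)) xy≤xz)
    where
    cancel : ∀ y → x ⁻¹ * (x * y) ≈ y
    cancel y = trans (sym (*-assoc _ _ _)) (trans (*-congʳ (x⁻¹*x≈1 0<x)) (*-identityˡ y))

  *-pos : ∀ {x y} → 0# < x → 0# < y → 0# < x * y
  *-pos {x} {y} 0<x 0<y = ≰⇒> λ xy≤0 → <⇒≱ 0<y
    (*-cancelˡ-≤ 0<x (≤-trans xy≤0 (≤-reflexive (sym (zeroʳ x)))))

  +-pos-nonneg : ∀ {x y} → 0# < x → 0# ≤ y → 0# < x + y
  +-pos-nonneg {x} 0<x 0≤y = <-≤-trans 0<x (≤-resp (+-identityʳ x) refl (+-monoʳ-≤ x 0≤y))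

  0≤fromℕ : ∀ n → 0# ≤ fromℕ n
  0≤fromℕ zero    = ≤-refl
  0≤fromℕ (suc n) = +-nonneg 0≤1 (0≤fromℕ n)

  0<fromℕ : ∀ n → 0# < fromℕ (suc n)
  0<fromℕ n = +-pos-nonneg 0<1 (0≤fromℕ n)

  fromℕ-+ : ∀ m n → fromℕ (m ℕ.+ n) ≈ fromℕ m + fromℕ n
  fromℕ-+ = Mult.×-homo-+ semiring 1#

  fromℕ-* : ∀ m n → fromℕ (m ℕ.* n) ≈ fromℕ m * fromℕ n
  fromℕ-* = Mult.×1-homo-* semiring

  fromℕ-mono-≤ : ∀ {m n} → m ℕ.≤ n → fromℕ m ≤ fromℕ n
  fromℕ-mono-≤ {n = n} ℕ.z≤n = 0≤fromℕ n
  fromℕ-mono-≤ (ℕ.s≤s m≤n)   = +-monoʳ-≤ 1# (fromℕ-mono-≤ m≤n)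

  n<1+n : ∀ n → fromℕ n < fromℕ (suc n)
  n<1+n n = ≰⇒> λ 1+n≤n → <⇒≱ 0<1 (≤-resp
    (solve 1 (λ n → :1 :+ n :- n := :1) refl (fromℕ n)) (-‿inverseʳ (fromℕ n)) (+-monoˡ-≤ (- fromℕ n) 1+n≤n))

  fromℕ-cancel-< : ∀ {m n} → fromℕ m < fromℕ n → m ℕ.< n
  fromℕ-cancel-< m<n = ℕ.≰⇒> λ n≤m → <⇒≱ m<n (fromℕ-mono-≤ n≤m)

  fromℕ-cancel-≤ : ∀ {m n} → fromℕ m ≤ fromℕ n → m ℕ.≤ n
  fromℕ-cancel-≤ {n = n} m≤n = ℕ.≮⇒≥ λ n<m →
    <⇒≱ (n<1+n n) (≤-trans (fromℕ-mono-≤ n<m) m≤n)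

  ^-nonneg : ∀ {x} n → 0# ≤ x → 0# ≤ x ^ n
  ^-nonneg zero    0≤x = 0≤1
  ^-nonneg (suc n) 0≤x = *-nonneg 0≤x (^-nonneg n 0≤x)

  ^-pos : ∀ {x} n → 0# < x → 0# < x ^ n
  ^-pos zero    0<x = 0<1
  ^-pos (suc n) 0<x = *-pos 0<x (^-pos n 0<x)

  ^-monoˡ-≤ : ∀ {x y} n → 0# ≤ x → x ≤ y → x ^ n ≤ y ^ n
  ^-monoˡ-≤ zero    0≤x x≤y = ≤-refl
  ^-monoˡ-≤ (suc n) 0≤x x≤y = *-mono-≤ 0≤x (^-nonneg n 0≤x) x≤y (^-monoˡ-≤ n 0≤x x≤y)

  1^n≈1 : ∀ n → 1# ^ n ≈ 1#
  1^n≈1 zero    = refl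
  1^n≈1 (suc n) = trans (*-identityˡ _) (1^n≈1 n)

  1≤x^n : ∀ {x} n → 1# ≤ x → 1# ≤ x ^ n
  1≤x^n n 1≤x = ≤-trans (≤-reflexive (sym (1^n≈1 n))) (^-monoˡ-≤ n 0≤1 1≤x)

  x^n≤1 : ∀ {x} n → 0# ≤ x → x ≤ 1# → x ^ n ≤ 1#
  x^n≤1 n 0≤x x≤1 = ≤-trans (^-monoˡ-≤ n 0≤x x≤1) (≤-reflexive (1^n≈1 n))

  ^-monoʳ-≤ : ∀ {x m n} → 1# ≤ x → m ℕ.≤ n → x ^ m ≤ x ^ n
  ^-monoʳ-≤ {n = n} 1≤x ℕ.z≤n     = 1≤x^n n 1≤x
  ^-monoʳ-≤         1≤x (ℕ.s≤s m≤n) = *-monoˡ-≤ (≤-trans 0≤1 1≤x) (^-monoʳ-≤ 1≤x m≤n)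

  ^-antimonoʳ-≤ : ∀ {x m n} → 0# ≤ x → x ≤ 1# → m ℕ.≤ n → x ^ n ≤ x ^ m
  ^-antimonoʳ-≤ {n = n} 0≤x x≤1 ℕ.z≤n     = x^n≤1 n 0≤x x≤1
  ^-antimonoʳ-≤         0≤x x≤1 (ℕ.s≤s m≤n) = *-monoˡ-≤ 0≤x (^-antimonoʳ-≤ 0≤x x≤1 m≤n)

  ^-monoˡ-< : ∀ {x y} n → 1 ℕ.≤ n → 0# ≤ x → x < y → x ^ n < y ^ n
  ^-monoˡ-< {x} {y} (suc n) _ 0≤x x<y = ≰⇒> λ yⁿ⁺¹≤xⁿ⁺¹ → <⇒≱ x<y
    (*-cancelˡ-≤ (^-pos n (≤-<-trans 0≤x x<y))
      (≤-trans (≤-resp (*-comm _ _) refl yⁿ⁺¹≤xⁿ⁺¹)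
        (≤-trans (*-monoˡ-≤ 0≤x (^-monoˡ-≤ n 0≤x (<⇒≤ x<y))) (≤-reflexive (*-comm _ _)))))

  ^-cancelˡ-≤ : ∀ {x y} n → 1 ℕ.≤ n → 0# ≤ y → x ^ n ≤ y ^ n → x ≤ y
  ^-cancelˡ-≤ {x} {y} n 1≤n 0≤y xⁿ≤yⁿ with x ≤? y
  ... | yes x≤y = x≤y
  ... | no  x≰y = contradiction xⁿ≤yⁿ (<⇒≱ (^-monoˡ-< n 1≤n 0≤y (≰⇒> x≰y)))

  -- Limits reduce to this: an error of order 1/n, multiplied by n, becomes a constant v. If u were
  -- positive, some n would satisfy v ≤ n u, and the next multiple would exceed v.
  bounded-multiples : ∀ {u v} → (∀ n → fromℕ (suc n) * u ≤ v) → u ≤ 0#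
  bounded-multiples {u} {v} nu≤v with u ≤? 0#
  ... | yes u≤0 = u≤0
  ... | no  u≰0 with n , v/u≤n ← archimedean (v * u ⁻¹) =
    contradiction (≤-trans (nu≤v n) v≤nu) (<⇒≱ nu<[1+n]u)
    where
    0<u : 0# < u
    0<u = ≰⇒> u≰0
    v≤nu : v ≤ fromℕ n * u
    v≤nu = ≤-resp (trans (*-assoc _ _ _) (trans (*-congˡ (x⁻¹*x≈1 0<u)) (*-identityʳ v))) refl
             (*-monoʳ-≤ (<⇒≤ 0<u) v/u≤n)
    nu<[1+n]u : fromℕ n * u < fromℕ (suc n) * u
    nu<[1+n]u = ≰⇒> λ p → <⇒≱ (n<1+n n) (*-cancelˡ-≤ 0<u (≤-resp (*-comm _ _) (*-comm _ _) p))

  abstract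
    -- The Archimedean bound is lowered one by one until it no longer exceeds z. Being `abstract`,
    -- the floor enters later arguments through its two inequalities only.
    ⌊_⌋-exists : ∀ z → 0# ≤ z → ∃ λ a → fromℕ a ≤ z × z < fromℕ (suc a)
    ⌊ z ⌋-exists 0≤z with n , z≤n ← archimedean z = search n (≤-<-1+ {n} z≤n)
      where
      ≤-<-1+ : ∀ {n} → z ≤ fromℕ n → z < fromℕ (suc n)
      ≤-<-1+ {n} z≤n = ≰⇒> λ 1+n≤z → <⇒≱ (n<1+n n) (≤-trans 1+n≤z z≤n)
      search : ∀ n → z < fromℕ (suc n) → ∃ λ a → fromℕ a ≤ z × z < fromℕ (suc a)
      search zero    z<1 = 0 , 0≤z , z<1
      search (suc n) z<2+n with fromℕ (suc n) ≤? z
      ... | yes 1+n≤z = suc n , 1+n≤z , z<2+n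
      ... | no  1+n≰z = search n (≰⇒> 1+n≰z)

-- Polynomial inequalities and n-th roots

module Roots (ℝ : RealNumbers) where
  open OrderedField ℝ public

  module Division (x : Carrier) {y : Carrier} (0<y : 0# < y) where
    quotient : Carrier
    quotient = x * y ⁻¹

    y*[x/y]≈x : y * quotient ≈ x
    y*[x/y]≈x = begin
      y * (x * y ⁻¹)  ≈⟨ solve 3 (λ x y z → y :* (x :* z) := x :* (y :* z)) refl x y (y ⁻¹) ⟩
      x * (y * y ⁻¹)  ≈⟨ *-congˡ (x*x⁻¹≈1 0<y) ⟩
      x * 1#          ≈⟨ *-identityʳ x ⟩
      x               ∎
      where open ≈-Reasoning

    0<x/y : 0# < x → 0# < quotient
    0<x/y 0<x = *-pos 0<x (0<x⁻¹ 0<y)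

  -- Bernoulli's inequality 1 + n (v / u) ≤ (1 + v / u) ^ n, multiplied by u ^ (n + 1) so that no
  -- division occurs.
  uⁿ[u+nv]≤u[u+v]ⁿ : ∀ {u v} n → 0# ≤ u → 0# ≤ v → u ^ n * (u + fromℕ n * v) ≤ u * (u + v) ^ n
  uⁿ[u+nv]≤u[u+v]ⁿ {u} {v} zero 0≤u 0≤v =
    ≤-reflexive (solve 2 (λ u v → :1 :* (u :+ :0 :* v) := u :* :1) refl u v)
  uⁿ[u+nv]≤u[u+v]ⁿ {u} {v} (suc n) 0≤u 0≤v = begin
    u * U * (u + (1# + N) * v)               ≤⟨ ≤-by (U * (N * (v * v)))
                                                (*-nonneg (^-nonneg n 0≤u) (*-nonneg (0≤fromℕ n) (0≤x² v)))
      (solve 4 (λ u v U N → u :* U :* (u :+ (:1 :+ N) :* v) :+ U :* (N :* (v :* v))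
                  := (u :+ v) :* (U :* (u :+ N :* v))) refl u v U N) ⟩
    (u + v) * (U * (u + N * v))              ≤⟨ *-monoˡ-≤ (+-nonneg 0≤u 0≤v) (uⁿ[u+nv]≤u[u+v]ⁿ n 0≤u 0≤v) ⟩
    (u + v) * (u * (u + v) ^ n)
      ≈⟨ solve 3 (λ u v V → (u :+ v) :* (u :* V) := u :* ((u :+ v) :* V)) refl u v ((u + v) ^ n) ⟩
    u * ((u + v) * (u + v) ^ n)              ∎
    where
    open ≤-Reasoning
    U N : Carrier
    U = u ^ n
    N = fromℕ n

  -- In other words, the n-th root of y is at most 1 + y / n. This is the source of the factors 1 +
  -- O(1/n) for real powers.
  y*nⁿ≤[n+y]ⁿ : ∀ {y} k → 0# ≤ y → let n = suc k in y * fromℕ n ^ n ≤ (fromℕ n + y) ^ n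
  y*nⁿ≤[n+y]ⁿ {y} k 0≤y = *-cancelˡ-≤ (0<fromℕ k) (≤-trans
    (≤-by (U * N) (*-nonneg (^-nonneg (suc k) 0≤N) 0≤N)
      (solve 3 (λ U N y → N :* (y :* U) :+ U :* N := U :* (N :+ N :* y)) refl U N y))
    (uⁿ[u+nv]≤u[u+v]ⁿ (suc k) 0≤N 0≤y))
    where
    N U : Carrier
    N = fromℕ (suc k)
    U = N ^ suc k
    0≤N : 0# ≤ N
    0≤N = 0≤fromℕ (suc k)

  -- Young's inequality, that is, the arithmetic-geometric mean inequality for one copy of z ^ (n +
  -- 1) and n copies of w ^ (n + 1). Multiplying the case n by z leaves a defect of (n + 1) w ^ n (z
  -- - w)², which is nonnegative.
  young : ∀ {z w} n → 0# ≤ z → 0# ≤ w → fromℕ (suc n) * (w ^ n * z) ≤ z ^ suc n + fromℕ n * w ^ suc n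
  young {z} {w} zero 0≤z 0≤w = ≤-reflexive
    (solve 2 (λ z w → (:1 :+ :0) :* (:1 :* z) := z :* :1 :+ :0 :* (w :* :1)) refl z w)
  young {z} {w} (suc n) 0≤z 0≤w = begin
    (1# + (1# + N)) * (w * W * z)
      ≤⟨ ≤-by ((1# + N) * W * ((z - w) * (z - w)))
           (*-nonneg (*-nonneg (0≤fromℕ (suc n)) (^-nonneg n 0≤w)) (0≤x² (z - w)))
           (solve 4 (λ z w N W →
              (:1 :+ (:1 :+ N)) :* (w :* W :* z) :+ (:1 :+ N) :* W :* ((z :- w) :* (z :- w))
              := z :* ((:1 :+ N) :* (W :* z)) :+ ((:1 :+ N) :* (w :* (w :* W)) :- N :* (w :* W) :* z))
            refl z w N W) ⟩
    z * ((1# + N) * (W * z)) + ((1# + N) * (w * (w * W)) - N * (w * W) * z)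
      ≤⟨ +-monoˡ-≤ _ (*-monoˡ-≤ 0≤z (young n 0≤z 0≤w)) ⟩
    z * (z * Z + N * (w * W)) + ((1# + N) * (w * (w * W)) - N * (w * W) * z)
      ≈⟨ solve 5 (λ z w N W Z →
           z :* (z :* Z :+ N :* (w :* W)) :+ ((:1 :+ N) :* (w :* (w :* W)) :- N :* (w :* W) :* z)
           := z :* (z :* Z) :+ (:1 :+ N) :* (w :* (w :* W))) refl z w N W Z ⟩
    z * (z * Z) + (1# + N) * (w * (w * W)) ∎
    where
    open ≤-Reasoning
    N W Z : Carrier
    N = fromℕ n
    W = w ^ n
    Z = z ^ n

  -- `young` read as convexity: the power at z lies above its tangent at w. It controls how far a
  -- power moves when its base is shifted.
  w^n≤z^n+slope : ∀ {z w} n → 0# ≤ z → 0# ≤ w →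
                  w ^ suc n ≤ z ^ suc n + fromℕ (suc n) * w ^ n * (w - z)
  w^n≤z^n+slope {z} {w} n 0≤z 0≤w = ≤-resp
    (solve 4 (λ z w N W → (:1 :+ N) :* (W :* z) :+ ((:1 :+ N) :* W :* (w :- z) :- N :* (w :* W)) := w :* W)
      refl z w N W)
    (solve 5 (λ z w N W Z → Z :+ N :* (w :* W) :+ ((:1 :+ N) :* W :* (w :- z) :- N :* (w :* W))
                            := Z :+ (:1 :+ N) :* W :* (w :- z))
      refl z w N W (z ^ suc n))
    (+-monoˡ-≤ (fromℕ (suc n) * W * (w - z) - N * (w * W)) (young n 0≤z 0≤w))
    where
    N W : Carrier
    N = fromℕ n
    W = w ^ n

  -- The arithmetic-geometric mean inequality for b copies of r and c copies of 1.
  amgm : ∀ {r} b c → 0# ≤ r →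
         fromℕ (c ℕ.+ b) ^ (c ℕ.+ b) * r ^ b ≤ (fromℕ b * r + fromℕ c) ^ (c ℕ.+ b)
  amgm {r} b zero 0≤r = ≤-reflexive (trans (sym (^-distrib-* (fromℕ b) r b)) (^-congˡ b (sym (+-identityʳ _))))
  amgm {r} zero (suc c) 0≤r = ≤-resp (sym (*-identityʳ _)) refl (^-monoˡ-≤ (suc (c ℕ.+ 0)) (0≤fromℕ (suc (c ℕ.+ 0)))
    (≤-reflexive (trans (+-congˡ (trans (fromℕ-+ c 0) (+-identityʳ _)))
      (solve 2 (λ r c → :1 :+ c := :0 :* r :+ (:1 :+ c)) refl r (fromℕ c)))))
  amgm {r} b@(suc b′) (suc c) 0≤r = *-cancelˡ-≤ 0<nⁿ (begin
    N * ((1# + n) * S * R)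
      ≈⟨ solve 4 (λ N n S R → N :* ((:1 :+ n) :* S :* R) := (:1 :+ n) :* S :* (N :* R)) refl N n S R ⟩
    (1# + n) * S * (N * R)                     ≤⟨ *-monoˡ-≤ (*-nonneg 0≤1+n (^-nonneg k 0≤1+n)) (amgm b c 0≤r) ⟩
    (1# + n) * S * M                           ≤⟨ step ⟩
    N * ((1# + m) ^ suc k)
      ≈⟨ *-congˡ (^-congˡ (suc k) (solve 2 (λ x c → :1 :+ (x :+ c) := x :+ (:1 :+ c)) refl (fromℕ b * r) (fromℕ c))) ⟩
    N * ((fromℕ b * r + (1# + fromℕ c)) ^ suc k) ∎)
    where
    open ≤-Reasoning
    k : ℕ
    k = c ℕ.+ b
    n m N S R M : Carrier
    n = fromℕ k
    m = fromℕ b * r + fromℕ c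
    N = n ^ k
    S = (1# + n) ^ k
    R = r ^ b
    M = m ^ k
    0<n : 0# < n
    0<n = <-≤-trans (0<fromℕ b′) (fromℕ-mono-≤ {b} {k} (ℕ.m≤n+m b c))
    0≤n : 0# ≤ n
    0≤n = <⇒≤ 0<n
    0<nⁿ : 0# < N
    0<nⁿ = ^-pos k 0<n
    0≤1+n : 0# ≤ 1# + n
    0≤1+n = 0≤fromℕ (suc k)
    0≤m : 0# ≤ m
    0≤m = +-nonneg (*-nonneg (0≤fromℕ b) 0≤r) (0≤fromℕ c)
    -- These are the arithmetic means (1 + m) / (1 + n) and m / n, with and without one further 1,
    -- both scaled by n (1 + n). Young's inequality for them yields (m / n) ^ k ≤ ((1 + m) / (1 +
    -- n)) ^ (k + 1). The scaling needs n > 0, hence the separate case b = 0.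
    z w W Z : Carrier
    z = n * (1# + m)
    w = (1# + n) * m
    W = w ^ k
    Z = (1# + m) ^ k
    step : (1# + n) * S * M ≤ N * ((1# + m) * Z)
    step = *-cancelˡ-≤ 0<n (0≤y-x⇒x≤y (≤-resp refl
      (≈-Reasoning.begin
        z * z ^ k + n * (w * W) - (1# + n) * (W * z)
          ≈-Reasoning.≈⟨ +-cong (+-cong (*-congˡ (^-distrib-* n (1# + m) k)) (*-congˡ (*-congˡ (^-distrib-* (1# + n) m k))))
                                (-‿cong (*-congˡ (*-congʳ (^-distrib-* (1# + n) m k)))) ⟩
        z * (N * Z) + n * (w * (S * M)) - (1# + n) * (S * M * z)
          ≈-Reasoning.≈⟨ solve 6 (λ n m N Z S M →
             n :* (:1 :+ m) :* (N :* Z) :+ n :* ((:1 :+ n) :* m :* (S :* M)) :- (:1 :+ n) :* (S :* M :* (n :* (:1 :+ m)))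
             := n :* (N :* ((:1 :+ m) :* Z)) :- n :* ((:1 :+ n) :* S :* M)) refl n m N Z S M ⟩
        n * (N * ((1# + m) * Z)) - n * ((1# + n) * S * M) ≈-Reasoning.∎)
      (x≤y⇒0≤y-x (young k (*-nonneg 0≤n (+-nonneg 0≤1 0≤m)) (*-nonneg 0≤1+n 0≤m)))))

  root : ℕ → Carrier → Carrier
  root k c = sup λ y → 0# ≤ y × y ^ suc k ≤ c

  -- Each inequality comes from moving the supremum r by some δ > 0. If r ^ n exceeded c, then r - δ
  -- would still be an upper bound; if it fell short of c, then r + δ would still belong to the set.
  -- Indexing by k with n = suc k excludes roots of order 0.
  root-spec : ∀ k {c} → 0# ≤ c → 0# ≤ root k c × root k c ^ suc k ≈ c
  root-spec k {c} 0≤c = 0≤r , ≤-antisym rⁿ≤c c≤rⁿ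
    where
    n : ℕ
    n = suc k
    S : Carrier → Set
    S y = 0# ≤ y × y ^ n ≤ c
    0∈S : S 0#
    0∈S = ≤-refl , ≤-resp (sym (zeroˡ _)) refl 0≤c
    S-bounded : UpperBound S (1# + c)
    S-bounded y (0≤y , yⁿ≤c) = ^-cancelˡ-≤ n (ℕ.s≤s ℕ.z≤n) (+-nonneg 0≤1 0≤c) (begin
      y ^ n                  ≤⟨ yⁿ≤c ⟩
      c                      ≤⟨ ≤-by 1# 0≤1 (+-comm _ _) ⟩
      1# + c                 ≈⟨ *-identityʳ _ ⟨
      (1# + c) * 1#          ≤⟨ *-monoˡ-≤ (+-nonneg 0≤1 0≤c) (1≤x^n k (≤-by c 0≤c refl)) ⟩
      (1# + c) * (1# + c) ^ k ∎)
      where open ≤-Reasoning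
    r : Carrier
    r = root k c
    r-sup : IsSupremum S r
    r-sup = complete S (0# , 0∈S) (1# + c , S-bounded)
    0≤r : 0# ≤ r
    0≤r = proj₁ r-sup 0# 0∈S

    rⁿ≤c : r ^ n ≤ c
    rⁿ≤c with r ^ n ≤? c
    ... | yes p = p
    ... | no rⁿ≰c = contradiction (proj₂ r-sup (r - δ) r-δ-bound) λ r≤r-δ →
        <⇒≱ 0<δ (≤-resp (solve 2 (λ r δ → r :- (r :- δ) := δ) refl r δ) (-‿inverseʳ (r - δ))
          (+-monoˡ-≤ (- (r - δ)) r≤r-δ))
      where
      0<r : 0# < r
      0<r = ≰⇒> λ r≤0 → rⁿ≰c (≤-trans (≤-trans (*-monoʳ-≤ (^-nonneg k 0≤r) r≤0) (≤-reflexive (zeroˡ _))) 0≤c)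
      d : Carrier
      d = r ^ n - c
      0<d : 0# < d
      0<d = ≰⇒> λ d≤0 → rⁿ≰c (≤-resp
        (solve 2 (λ x c → x :- c :+ c := x) refl (r ^ n) c) (+-identityˡ c) (+-monoˡ-≤ c d≤0))
      -- This δ is a Newton step for the equation y ^ n = c. By convexity such a step cannot
      -- overshoot the root, so (r - δ) ^ n is still at least c.
      open Division d (*-pos (0<fromℕ k) (^-pos k 0<r)) renaming (quotient to δ; y*[x/y]≈x to slope)
      0<δ : 0# < δ
      0<δ = 0<x/y 0<d
      0≤r-δ : 0# ≤ r - δ
      0≤r-δ = x≤y⇒0≤y-x (*-cancelˡ-≤ (*-pos (0<fromℕ k) (^-pos k 0<r)) (begin
        fromℕ n * r ^ k * δ            ≈⟨ slope ⟩
        r * r ^ k - c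
          ≤⟨ ≤-by (c + fromℕ k * (r ^ k * r)) (+-nonneg 0≤c (*-nonneg (0≤fromℕ k) (*-nonneg (^-nonneg k 0≤r) 0≤r)))
          (solve 4 (λ r R c K → r :* R :- c :+ (c :+ K :* (R :* r)) := (:1 :+ K) :* R :* r) refl r (r ^ k) c (fromℕ k)) ⟩
        fromℕ n * r ^ k * r            ∎))
        where open ≤-Reasoning
      c≤[r-δ]ⁿ : c ≤ (r - δ) ^ n
      c≤[r-δ]ⁿ = ≤-resp (solve 2 (λ x c → x :- (x :- c) := c) refl (r ^ n) c)
        (solve 2 (λ x d → x :+ d :- d := x) refl ((r - δ) ^ n) d)
        (+-monoˡ-≤ (- d) (≤-trans (w^n≤z^n+slope k 0≤r-δ 0≤r)
          (≤-reflexive (+-congˡ (trans (*-congˡ (solve 2 (λ r δ → r :- (r :- δ) := δ) refl r δ)) slope)))))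
      r-δ-bound : UpperBound S (r - δ)
      r-δ-bound y (0≤y , yⁿ≤c) = ^-cancelˡ-≤ n (ℕ.s≤s ℕ.z≤n) 0≤r-δ (≤-trans yⁿ≤c c≤[r-δ]ⁿ)

    c≤rⁿ : c ≤ r ^ n
    c≤rⁿ with c ≤? r ^ n
    ... | yes p = p
    ... | no c≰rⁿ = contradiction (proj₁ r-sup (r + δ) (+-nonneg 0≤r 0≤δ , [r+δ]ⁿ≤c)) λ r+δ≤r →
        <⇒≱ 0<δ (≤-resp (solve 2 (λ r δ → r :+ δ :- r := δ) refl r δ) (-‿inverseʳ r) (+-monoˡ-≤ (- r) r+δ≤r))
      where
      d q : Carrier
      d = c - r ^ n
      q = fromℕ n * (r + 1#) ^ k
      0≤d : 0# ≤ d
      0≤d = x≤y⇒0≤y-x (<⇒≤ (≰⇒> c≰rⁿ))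
      0<d : 0# < d
      0<d = ≰⇒> λ d≤0 → c≰rⁿ (≤-resp
        (solve 2 (λ x c → c :- x :+ x := c) refl (r ^ n) c) (+-identityˡ (r ^ n)) (+-monoˡ-≤ (r ^ n) d≤0))
      0≤r+1 : 0# ≤ r + 1#
      0≤r+1 = +-nonneg 0≤r 0≤1
      0≤q : 0# ≤ q
      0≤q = *-nonneg (0≤fromℕ n) (^-nonneg k 0≤r+1)
      -- Here q bounds the slope of the power on the interval from r to r + 1. Dividing by d + q
      -- instead of q also gives δ ≤ 1, which keeps r + δ in that interval.
      open Division d (+-pos-nonneg 0<d 0≤q) renaming (quotient to δ; y*[x/y]≈x to slope)
      0<δ : 0# < δ
      0<δ = 0<x/y 0<d
      0≤δ : 0# ≤ δ
      0≤δ = <⇒≤ 0<δ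
      δ≤1 : δ ≤ 1#
      δ≤1 = *-cancelˡ-≤ (+-pos-nonneg 0<d 0≤q)
        (≤-resp (sym slope) (sym (*-identityʳ _)) (≤-by q 0≤q refl))
      qδ≤d : q * δ ≤ d
      qδ≤d = ≤-by (d * δ) (*-nonneg 0≤d 0≤δ)
        (trans (solve 3 (λ q d δ → q :* δ :+ d :* δ := (d :+ q) :* δ) refl q d δ) slope)
      [r+δ]ⁿ≤c : (r + δ) ^ n ≤ c
      [r+δ]ⁿ≤c = begin
        (r + δ) ^ n
          ≤⟨ w^n≤z^n+slope k 0≤r (+-nonneg 0≤r 0≤δ) ⟩
        r ^ n + fromℕ n * (r + δ) ^ k * (r + δ - r)
          ≈⟨ +-congˡ (*-congˡ (solve 2 (λ r δ → r :+ δ :- r := δ) refl r δ)) ⟩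
        r ^ n + fromℕ n * (r + δ) ^ k * δ
          ≤⟨ +-monoʳ-≤ _ (*-monoʳ-≤ 0≤δ (*-monoˡ-≤ (0≤fromℕ n)
               (^-monoˡ-≤ k (+-nonneg 0≤r 0≤δ) (+-monoʳ-≤ r δ≤1)))) ⟩
        r ^ n + q * δ
          ≤⟨ +-monoʳ-≤ _ qδ≤d ⟩
        r ^ n + (c - r ^ n)
          ≈⟨ solve 2 (λ x c → x :+ (c :- x) := c) refl (r ^ n) c ⟩
        c ∎
        where open ≤-Reasoning

-- Real powers: approximation, multiplicativity, Bernoulli's inequality, inverse exponents

module RealPowers (ℝ : RealNumbers) where
  open Roots ℝ public
  open Discrepancy ℝ using (_^ʳ_) public

  root-mono-≤ : ∀ k {c d} → 0# ≤ c → c ≤ d → root k c ≤ root k d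
  root-mono-≤ k 0≤c c≤d = ^-cancelˡ-≤ (suc k) (ℕ.s≤s ℕ.z≤n) (proj₁ (root-spec k 0≤d))
    (≤-resp (sym (proj₂ (root-spec k 0≤c))) (sym (proj₂ (root-spec k 0≤d))) c≤d)
    where 0≤d = ≤-trans 0≤c c≤d

  root-unique-≤ : ∀ k {c s} → 0# ≤ c → 0# ≤ s → s ^ suc k ≤ c → s ≤ root k c
  root-unique-≤ k 0≤c 0≤s sⁿ≤c = ^-cancelˡ-≤ (suc k) (ℕ.s≤s ℕ.z≤n) (proj₁ (root-spec k 0≤c))
    (≤-trans sⁿ≤c (≤-reflexive (sym (proj₂ (root-spec k 0≤c)))))

  root-unique-≥ : ∀ k {c s} → 0# ≤ c → 0# ≤ s → c ≤ s ^ suc k → root k c ≤ s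
  root-unique-≥ k 0≤c 0≤s c≤sⁿ = ^-cancelˡ-≤ (suc k) (ℕ.s≤s ℕ.z≤n) 0≤s
    (≤-trans (≤-reflexive (proj₂ (root-spec k 0≤c))) c≤sⁿ)

  -- u ⪅ v says that u is at most v up to a factor 1 + O(1/n), where n = suc k.
  infix 4 _⪅_
  _⪅_ : (u v : ℕ → Carrier) → Set
  u ⪅ v = ∃ λ K → 0# ≤ K × ∀ k → fromℕ (suc k) * u k ≤ (fromℕ (suc k) + K) * v k

  private
    -- After division by n² this says (1 + K / n) (1 + L / n) ≤ 1 + (K + L + K L) / n, since K L /
    -- n² is at most K L / n.
    factors-combine : ∀ {K L v} k → 0# ≤ K → 0# ≤ L → 0# ≤ v → let n = fromℕ (suc k) in
                      (n + K) * (n + L) * v ≤ n * ((n + (K + L + K * L)) * v)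
    factors-combine {K} {L} {v} k 0≤K 0≤L 0≤v = ≤-by (fromℕ k * (K * L * v))
      (*-nonneg (0≤fromℕ k) (*-nonneg (*-nonneg 0≤K 0≤L) 0≤v))
      (solve 4 (λ m K L v → (:1 :+ m :+ K) :* (:1 :+ m :+ L) :* v :+ m :* (K :* L :* v)
         := (:1 :+ m) :* ((:1 :+ m :+ (K :+ L :+ K :* L)) :* v)) refl (fromℕ k) K L v)

    0≤K+L+KL : ∀ {K L} → 0# ≤ K → 0# ≤ L → 0# ≤ K + L + K * L
    0≤K+L+KL 0≤K 0≤L = +-nonneg (+-nonneg 0≤K 0≤L) (*-nonneg 0≤K 0≤L)

  ≤⇒⪅ : ∀ {u v} → (∀ k → u k ≤ v k) → u ⪅ v
  ≤⇒⪅ u≤v = 0# , ≤-refl , λ k →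
    ≤-trans (*-monoˡ-≤ (0≤fromℕ (suc k)) (u≤v k)) (≤-reflexive (*-congʳ (sym (+-identityʳ _))))

  ⪅-trans : ∀ {u v w} → (∀ k → 0# ≤ w k) → u ⪅ v → v ⪅ w → u ⪅ w
  ⪅-trans {u} {v} {w} 0≤w (K , 0≤K , u≤v) (L , 0≤L , v≤w) =
    K + L + K * L , 0≤K+L+KL 0≤K 0≤L , λ k → *-cancelˡ-≤ (0<fromℕ k) (begin
      fromℕ (suc k) * (fromℕ (suc k) * u k)
        ≤⟨ *-monoˡ-≤ (0≤fromℕ (suc k)) (u≤v k) ⟩
      fromℕ (suc k) * ((fromℕ (suc k) + K) * v k)
        ≈⟨ solve 3 (λ n c v → n :* (c :* v) := c :* (n :* v)) refl (fromℕ (suc k)) (fromℕ (suc k) + K) (v k) ⟩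
      (fromℕ (suc k) + K) * (fromℕ (suc k) * v k)
        ≤⟨ *-monoˡ-≤ (+-nonneg (0≤fromℕ (suc k)) 0≤K) (v≤w k) ⟩
      (fromℕ (suc k) + K) * ((fromℕ (suc k) + L) * w k)
        ≈⟨ *-assoc _ _ _ ⟨
      (fromℕ (suc k) + K) * (fromℕ (suc k) + L) * w k
        ≤⟨ factors-combine k 0≤K 0≤L (0≤w k) ⟩
      fromℕ (suc k) * ((fromℕ (suc k) + (K + L + K * L)) * w k) ∎)
    where open ≤-Reasoning

  ⪅-* : ∀ {u u′ v v′} → (∀ k → 0# ≤ u k) → (∀ k → 0# ≤ u′ k) → (∀ k → 0# ≤ v k) → (∀ k → 0# ≤ v′ k) →
        u ⪅ v → u′ ⪅ v′ → (λ k → u k * u′ k) ⪅ (λ k → v k * v′ k)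
  ⪅-* {u} {u′} {v} {v′} 0≤u 0≤u′ 0≤v 0≤v′ (K , 0≤K , u≤v) (L , 0≤L , u′≤v′) =
    K + L + K * L , 0≤K+L+KL 0≤K 0≤L , λ k → *-cancelˡ-≤ (0<fromℕ k) (begin
      fromℕ (suc k) * (fromℕ (suc k) * (u k * u′ k))
        ≈⟨ solve 3 (λ n u v → n :* (n :* (u :* v)) := n :* u :* (n :* v)) refl (fromℕ (suc k)) (u k) (u′ k) ⟩
      fromℕ (suc k) * u k * (fromℕ (suc k) * u′ k)
        ≤⟨ *-mono-≤ (*-nonneg (0≤fromℕ (suc k)) (0≤u k)) (*-nonneg (0≤fromℕ (suc k)) (0≤u′ k)) (u≤v k) (u′≤v′ k) ⟩
      (fromℕ (suc k) + K) * v k * ((fromℕ (suc k) + L) * v′ k)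
        ≈⟨ solve 4 (λ a u b v → a :* u :* (b :* v) := a :* b :* (u :* v)) refl
             (fromℕ (suc k) + K) (v k) (fromℕ (suc k) + L) (v′ k) ⟩
      (fromℕ (suc k) + K) * (fromℕ (suc k) + L) * (v k * v′ k)
        ≤⟨ factors-combine k 0≤K 0≤L (*-nonneg (0≤v k) (0≤v′ k)) ⟩
      fromℕ (suc k) * ((fromℕ (suc k) + (K + L + K * L)) * (v k * v′ k)) ∎)
    where open ≤-Reasoning

  -- For constant sequences the relation says n (u - v) ≤ K v for every n ≥ 1, which forces u - v ≤
  -- 0.
  ⪅-const : ∀ {u v} → (λ _ → u) ⪅ (λ _ → v) → u ≤ v
  ⪅-const {u} {v} (K , _ , u≤v) = ≤-resp
    (solve 2 (λ u v → u :- v :+ v := u) refl u v) (+-identityˡ v)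
    (+-monoˡ-≤ v (bounded-multiples {v = K * v} λ k → ≤-resp
      (solve 3 (λ n u v → n :* u :- n :* v := n :* (u :- v)) refl (fromℕ (suc k)) u v)
      (solve 3 (λ n K v → (n :+ K) :* v :- n :* v := K :* v) refl (fromℕ (suc k)) K v)
      (+-monoˡ-≤ (- (fromℕ (suc k) * v)) (u≤v k))))

  -- The set whose supremum defines `x ^ʳ e`.
  Below : Carrier → Carrier → Carrier → Set
  Below x e y = 0# ≤ y × ∃₂ λ a b →
    1 ℕ.≤ b ×
    ((1# ≤ x × fromℕ a ≤ e * fromℕ b) ⊎ (x ≤ 1# × e * fromℕ b ≤ fromℕ a)) ×
    y ^ b ≤ x ^ a

  module Power {e : Carrier} (0<e : 0# < e) where
    private
      0≤e : 0# ≤ e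
      0≤e = <⇒≤ 0<e

    -- A witness from the side x ≤ 1 forces x = 1, where all powers agree, so its exponent may be
    -- exchanged for one on the required side of e. Here 0 will do; `below-≤1` takes an Archimedean
    -- bound.
    below-1≤ : ∀ {x y} → 1# ≤ x → Below x e y →
               ∃₂ λ a b → 1 ℕ.≤ b × fromℕ a ≤ e * fromℕ b × y ^ b ≤ x ^ a
    below-1≤ 1≤x (_ , a , b , 1≤b , inj₁ (_ , a≤eb) , yᵇ≤xᵃ) = a , b , 1≤b , a≤eb , yᵇ≤xᵃ
    below-1≤ 1≤x (_ , a , b , 1≤b , inj₂ (x≤1 , _) , yᵇ≤xᵃ) =
      0 , b , 1≤b , *-nonneg 0≤e (0≤fromℕ b) , ≤-trans yᵇ≤xᵃ (x^n≤1 a (≤-trans 0≤1 1≤x) x≤1)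

    below-≤1 : ∀ {x y} → 0# ≤ x → x ≤ 1# → Below x e y →
               ∃₂ λ a b → 1 ℕ.≤ b × e * fromℕ b ≤ fromℕ a × y ^ b ≤ x ^ a
    below-≤1 0≤x x≤1 (_ , a , b , 1≤b , inj₂ (_ , eb≤a) , yᵇ≤xᵃ) = a , b , 1≤b , eb≤a , yᵇ≤xᵃ
    below-≤1 0≤x x≤1 (_ , a , b , 1≤b , inj₁ (1≤x , _) , yᵇ≤xᵃ) with c , eb≤c ← archimedean (e * fromℕ b) =
      c , b , 1≤b , eb≤c , ≤-trans yᵇ≤xᵃ (≤-trans (x^n≤1 a 0≤x x≤1) (1≤x^n c 1≤x))

    0-below : ∀ {x} → 0# ≤ x → Below x e 0#
    0-below {x} 0≤x with total 1# x
    ... | inj₁ 1≤x = ≤-refl , 0 , 1 , ℕ.≤-refl ,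
                     inj₁ (1≤x , *-nonneg 0≤e (0≤fromℕ 1)) , ≤-resp (sym (zeroˡ _)) refl 0≤1
    ... | inj₂ x≤1 with a , e≤a ← archimedean (e * fromℕ 1) =
      ≤-refl , a , 1 , ℕ.≤-refl , inj₂ (x≤1 , e≤a) , ≤-resp (sym (zeroˡ _)) refl (^-nonneg a 0≤x)

    below-bounded : ∀ {x} → 0# ≤ x → ∃ (UpperBound (Below x e))
    below-bounded {x} 0≤x with total 1# x
    ... | inj₂ x≤1 = 1# , λ y y∈ → let a , b , 1≤b , _ , yᵇ≤xᵃ = below-≤1 0≤x x≤1 y∈ in
      ^-cancelˡ-≤ b 1≤b 0≤1 (≤-trans yᵇ≤xᵃ (≤-trans (x^n≤1 a 0≤x x≤1) (≤-reflexive (sym (1^n≈1 b)))))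
    ... | inj₁ 1≤x with n , e≤n ← archimedean e =
      x ^ n , λ y y∈ → let a , b , 1≤b , a≤eb , yᵇ≤xᵃ = below-1≤ 1≤x y∈ in
      ^-cancelˡ-≤ b 1≤b (^-nonneg n 0≤x) (≤-trans yᵇ≤xᵃ (≤-trans
        (^-monoʳ-≤ 1≤x (fromℕ-cancel-≤ {a} {n ℕ.* b} (≤-trans a≤eb
          (≤-trans (*-monoʳ-≤ (0≤fromℕ b) e≤n) (≤-reflexive (sym (fromℕ-* n b)))))))
        (≤-reflexive (sym (^-assocʳ x n b)))))

    ^ʳ-isSupremum : ∀ {x} → 0# ≤ x → IsSupremum (Below x e) (x ^ʳ e)
    ^ʳ-isSupremum 0≤x = complete _ (0# , 0-below 0≤x) (below-bounded 0≤x)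

    ^ʳ-nonneg : ∀ {x} → 0# ≤ x → 0# ≤ x ^ʳ e
    ^ʳ-nonneg 0≤x = proj₁ (^ʳ-isSupremum 0≤x) 0# (0-below 0≤x)

    ^ʳ-zero : ∀ {x} → x ≈ 0# → x ^ʳ e ≈ 0#
    ^ʳ-zero {x} x≈0 = ≤-antisym (proj₂ (^ʳ-isSupremum 0≤x) 0# below≤0) (^ʳ-nonneg 0≤x)
      where
      0≤x : 0# ≤ x
      0≤x = ≤-reflexive (sym x≈0)
      below≤0 : UpperBound (Below x e) 0#
      below≤0 y y∈ with below-≤1 0≤x (≤-trans (≤-reflexive x≈0) 0≤1) y∈
      -- With a = 0 the bound x ^ a would be 1 and say nothing; this is excluded because e b > 0.
      ... | zero  , suc b , _ , eb≤0 , _ = contradiction eb≤0 (<⇒≱ (*-pos 0<e (0<fromℕ b)))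
      ... | suc a , suc b , 1≤b , _ , yᵇ≤xᵃ = ^-cancelˡ-≤ (suc b) 1≤b ≤-refl
        (≤-trans yᵇ≤xᵃ (≤-reflexive (trans (*-congʳ x≈0) (trans (zeroˡ _) (sym (zeroˡ _))))))

    ^ʳ-one : 1# ^ʳ e ≈ 1#
    ^ʳ-one = ≤-antisym
      (proj₂ (^ʳ-isSupremum 0≤1) 1# λ y y∈ → let a , b , 1≤b , _ , yᵇ≤1ᵃ = below-≤1 0≤1 ≤-refl y∈ in
        ^-cancelˡ-≤ b 1≤b 0≤1 (≤-resp refl (trans (1^n≈1 a) (sym (1^n≈1 b))) yᵇ≤1ᵃ))
      (proj₁ (^ʳ-isSupremum 0≤1) 1# (0≤1 , 0 , 1 , ℕ.≤-refl ,
        inj₁ (≤-refl , *-nonneg 0≤e (0≤fromℕ 1)) , ≤-reflexive (*-identityʳ 1#)))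

    private
      cross-multiply : ∀ {a b c d} → fromℕ a ≤ e * fromℕ b → e * fromℕ d ≤ fromℕ c → a ℕ.* d ℕ.≤ c ℕ.* b
      cross-multiply {a} {b} {c} {d} a≤eb ed≤c = fromℕ-cancel-≤ {a ℕ.* d} {c ℕ.* b} (begin
        fromℕ (a ℕ.* d)             ≈⟨ fromℕ-* a d ⟩
        fromℕ a * fromℕ d           ≤⟨ *-monoʳ-≤ (0≤fromℕ d) a≤eb ⟩
        e * fromℕ b * fromℕ d       ≈⟨ solve 3 (λ e b d → e :* b :* d := e :* d :* b) refl e (fromℕ b) (fromℕ d) ⟩
        e * fromℕ d * fromℕ b       ≤⟨ *-monoʳ-≤ (0≤fromℕ b) ed≤c ⟩
        fromℕ c * fromℕ b           ≈⟨ fromℕ-* c b ⟨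
        fromℕ (c ℕ.* b)             ∎)
        where open ≤-Reasoning

      cross-powers : ∀ {x y s} a b c d → 0# ≤ x → 0# ≤ y → 0# ≤ s → 1 ℕ.≤ b → 1 ℕ.≤ d →
                     y ^ b ≤ x ^ a → x ^ (a ℕ.* d) ≤ x ^ (c ℕ.* b) → x ^ c ≤ s ^ d → y ≤ s
      cross-powers {x} {y} {s} a b c d 0≤x 0≤y 0≤s 1≤b 1≤d yᵇ≤xᵃ xᵃᵈ≤xᶜᵇ xᶜ≤sᵈ =
        ^-cancelˡ-≤ (b ℕ.* d) (ℕ.*-mono-≤ 1≤b 1≤d) 0≤s (begin
          y ^ (b ℕ.* d)    ≈⟨ ^-assocʳ y b d ⟨
          (y ^ b) ^ d      ≤⟨ ^-monoˡ-≤ d (^-nonneg b 0≤y) yᵇ≤xᵃ ⟩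
          (x ^ a) ^ d      ≈⟨ ^-assocʳ x a d ⟩
          x ^ (a ℕ.* d)    ≤⟨ xᵃᵈ≤xᶜᵇ ⟩
          x ^ (c ℕ.* b)    ≈⟨ ^-assocʳ x c b ⟨
          (x ^ c) ^ b      ≤⟨ ^-monoˡ-≤ b (^-nonneg c 0≤x) xᶜ≤sᵈ ⟩
          (s ^ d) ^ b      ≈⟨ ^-assocʳ s d b ⟩
          s ^ (d ℕ.* b)    ≡⟨ ≡.cong (s ^_) (ℕ.*-comm d b) ⟩
          s ^ (b ℕ.* d)    ∎)
        where open ≤-Reasoning

    -- Elements of the set give lower bounds for the supremum. For an upper bound, a rational c / d
    -- on the other side of e is compared with every a / b in the set: from a / b ≤ e ≤ c / d
    -- follows x ^ (a d) ≤ x ^ (c b).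
    ^ʳ-upper-1≤ : ∀ {x s} c d → 1 ℕ.≤ d → 1# ≤ x → 0# ≤ s →
                  e * fromℕ d ≤ fromℕ c → x ^ c ≤ s ^ d → x ^ʳ e ≤ s
    ^ʳ-upper-1≤ {x} {s} c d 1≤d 1≤x 0≤s ed≤c xᶜ≤sᵈ = proj₂ (^ʳ-isSupremum 0≤x) s λ y y∈ →
      let a , b , 1≤b , a≤eb , yᵇ≤xᵃ = below-1≤ 1≤x y∈ in
      cross-powers a b c d 0≤x (proj₁ y∈) 0≤s 1≤b 1≤d yᵇ≤xᵃ
        (^-monoʳ-≤ 1≤x (cross-multiply {a} {b} {c} {d} a≤eb ed≤c)) xᶜ≤sᵈ
      where 0≤x = ≤-trans 0≤1 1≤x

    ^ʳ-upper-≤1 : ∀ {x s} c d → 1 ℕ.≤ d → 0# ≤ x → x ≤ 1# → 0# ≤ s →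
                  fromℕ c ≤ e * fromℕ d → x ^ c ≤ s ^ d → x ^ʳ e ≤ s
    ^ʳ-upper-≤1 {x} {s} c d 1≤d 0≤x x≤1 0≤s c≤ed xᶜ≤sᵈ = proj₂ (^ʳ-isSupremum 0≤x) s λ y y∈ →
      let a , b , 1≤b , eb≤a , yᵇ≤xᵃ = below-≤1 0≤x x≤1 y∈ in
      cross-powers a b c d 0≤x (proj₁ y∈) 0≤s 1≤b 1≤d yᵇ≤xᵃ
        (^-antimonoʳ-≤ 0≤x x≤1 (cross-multiply {c} {d} {a} {b} c≤ed eb≤a)) xᶜ≤sᵈ

    ⌊e*_⌋ : ℕ → ℕ
    ⌊e* n ⌋ = proj₁ (⌊ e * fromℕ n ⌋-exists (*-nonneg 0≤e (0≤fromℕ n)))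

    ⌊e*n⌋≤ : ∀ n → fromℕ ⌊e* n ⌋ ≤ e * fromℕ n
    ⌊e*n⌋≤ n = proj₁ (proj₂ (⌊ e * fromℕ n ⌋-exists (*-nonneg 0≤e (0≤fromℕ n))))

    <1+⌊e*n⌋ : ∀ n → e * fromℕ n < fromℕ (suc ⌊e* n ⌋)
    <1+⌊e*n⌋ n = proj₂ (proj₂ (⌊ e * fromℕ n ⌋-exists (*-nonneg 0≤e (0≤fromℕ n))))

    approx : Carrier → ℕ → Carrier
    approx x k = root k (x ^ ⌊e* suc k ⌋)

    module _ {x} (0≤x : 0# ≤ x) (k : ℕ) where
      approx-nonneg : 0# ≤ approx x k
      approx-nonneg = proj₁ (root-spec k (^-nonneg ⌊e* suc k ⌋ 0≤x))

      approx-^ : approx x k ^ suc k ≈ x ^ ⌊e* suc k ⌋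
      approx-^ = proj₂ (root-spec k (^-nonneg ⌊e* suc k ⌋ 0≤x))

      private
        -- `approx` and `next` use two rationals with denominator n that enclose e. For x > 0 the
        -- ratio of `next` to `approx` is the n-th root of x, which tends to 1.
        next : Carrier
        next = root k (x ^ suc ⌊e* suc k ⌋)

      next-nonneg : 0# ≤ next
      next-nonneg = proj₁ (root-spec k (^-nonneg (suc ⌊e* suc k ⌋) 0≤x))

      next-^ : next ^ suc k ≈ x ^ suc ⌊e* suc k ⌋
      next-^ = proj₂ (root-spec k (^-nonneg (suc ⌊e* suc k ⌋) 0≤x))

    private
      -- On taking roots, s is at most r times the n-th root of y, and `y*nⁿ≤[n+y]ⁿ` bounds that
      -- root by 1 + y / n.
      n*s≤[n+y]*r : ∀ {r s y} k → 0# ≤ r → 0# ≤ s → 0# ≤ y → s ^ suc k ≤ r ^ suc k * y →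
                    fromℕ (suc k) * s ≤ (fromℕ (suc k) + y) * r
      n*s≤[n+y]*r {r} {s} {y} k 0≤r 0≤s 0≤y sⁿ≤rⁿy =
        ^-cancelˡ-≤ n (ℕ.s≤s ℕ.z≤n) (*-nonneg (+-nonneg (0≤fromℕ n) 0≤y) 0≤r) (begin
          (fromℕ n * s) ^ n              ≈⟨ ^-distrib-* (fromℕ n) s n ⟩
          fromℕ n ^ n * s ^ n            ≤⟨ *-monoˡ-≤ (^-nonneg n (0≤fromℕ n)) sⁿ≤rⁿy ⟩
          fromℕ n ^ n * (r ^ n * y)      ≈⟨ solve 3 (λ N R y → N :* (R :* y) := y :* N :* R) refl (fromℕ n ^ n) (r ^ n) y ⟩
          y * fromℕ n ^ n * r ^ n        ≤⟨ *-monoʳ-≤ (^-nonneg n 0≤r) (y*nⁿ≤[n+y]ⁿ k 0≤y) ⟩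
          (fromℕ n + y) ^ n * r ^ n      ≈⟨ ^-distrib-* (fromℕ n + y) r n ⟨
          ((fromℕ n + y) * r) ^ n        ∎)
        where
        open ≤-Reasoning
        n : ℕ
        n = suc k

    approx⪅^ʳ : ∀ {x} → 0# < x → approx x ⪅ (λ _ → x ^ʳ e)
    approx⪅^ʳ {x} 0<x with total 1# x
    ... | inj₁ 1≤x = ≤⇒⪅ λ k → proj₁ (^ʳ-isSupremum 0≤x) _
        (approx-nonneg 0≤x k , ⌊e* suc k ⌋ , suc k , ℕ.s≤s ℕ.z≤n ,
         inj₁ (1≤x , ⌊e*n⌋≤ (suc k)) , ≤-reflexive (approx-^ 0≤x k))
      where 0≤x = <⇒≤ 0<x
    -- For x ≤ 1, rounding e down makes the power larger, so `approx x k` need not lie in the set.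
    -- The root with exponent ⌊e n⌋ + 1 does, and it is smaller by a factor equal to the n-th root
    -- of `x ⁻¹`; hence the constant.
    ... | inj₂ x≤1 = x ⁻¹ , 0≤x⁻¹ , λ k → ≤-trans
        (n*s≤[n+y]*r k (next-nonneg 0≤x k) (approx-nonneg 0≤x k) 0≤x⁻¹ (≤-reflexive (sⁿ≈rⁿx⁻¹ k)))
        (*-monoˡ-≤ (+-nonneg (0≤fromℕ (suc k)) 0≤x⁻¹) (proj₁ (^ʳ-isSupremum 0≤x) _
          (next-nonneg 0≤x k , suc ⌊e* suc k ⌋ , suc k , ℕ.s≤s ℕ.z≤n ,
           inj₂ (x≤1 , <⇒≤ (<1+⌊e*n⌋ (suc k))) , ≤-reflexive (next-^ 0≤x k))))
      where
      0≤x = <⇒≤ 0<x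
      0≤x⁻¹ = <⇒≤ (0<x⁻¹ 0<x)
      sⁿ≈rⁿx⁻¹ : ∀ k → approx x k ^ suc k ≈ root k (x ^ suc ⌊e* suc k ⌋) ^ suc k * x ⁻¹
      sⁿ≈rⁿx⁻¹ k = begin
        approx x k ^ suc k                               ≈⟨ approx-^ 0≤x k ⟩
        X                                                ≈⟨ *-identityʳ X ⟨
        X * 1#                                           ≈⟨ *-congˡ (x*x⁻¹≈1 0<x) ⟨
        X * (x * x ⁻¹)                                   ≈⟨ solve 3 (λ X x y → X :* (x :* y) := x :* X :* y) refl X x (x ⁻¹) ⟩
        x * X * x ⁻¹                                     ≈⟨ *-congʳ (next-^ 0≤x k) ⟨
        root k (x ^ suc ⌊e* suc k ⌋) ^ suc k * x ⁻¹      ∎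
        where
        open ≈-Reasoning
        X : Carrier
        X = x ^ ⌊e* suc k ⌋

    ^ʳ⪅approx : ∀ {x} → 0# < x → (λ _ → x ^ʳ e) ⪅ approx x
    ^ʳ⪅approx {x} 0<x with total 1# x
    ... | inj₁ 1≤x = x , 0≤x , λ k → ≤-trans
        (*-monoˡ-≤ (0≤fromℕ (suc k)) (^ʳ-upper-1≤ (suc ⌊e* suc k ⌋) (suc k) (ℕ.s≤s ℕ.z≤n) 1≤x (next-nonneg 0≤x k)
          (<⇒≤ (<1+⌊e*n⌋ (suc k))) (≤-reflexive (sym (next-^ 0≤x k)))))
        (n*s≤[n+y]*r k (approx-nonneg 0≤x k) (next-nonneg 0≤x k) 0≤x (≤-reflexive
          (trans (next-^ 0≤x k) (trans (*-comm _ _) (*-congʳ (sym (approx-^ 0≤x k)))))))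
      where 0≤x = <⇒≤ 0<x
    ... | inj₂ x≤1 = ≤⇒⪅ λ k → ^ʳ-upper-≤1 ⌊e* suc k ⌋ (suc k) (ℕ.s≤s ℕ.z≤n) 0≤x x≤1 (approx-nonneg 0≤x k)
        (⌊e*n⌋≤ (suc k)) (≤-reflexive (sym (approx-^ 0≤x k)))
      where 0≤x = <⇒≤ 0<x

    -- Exact because the exponent ⌊e n⌋ does not depend on the base.
    approx-* : ∀ {x y} → 0# ≤ x → 0# ≤ y → ∀ k → approx (x * y) k ≈ approx x k * approx y k
    approx-* {x} {y} 0≤x 0≤y k = ≤-antisym
      (root-unique-≥ k (^-nonneg a 0≤xy) (*-nonneg (approx-nonneg 0≤x k) (approx-nonneg 0≤y k)) (≤-reflexive (sym powers)))
      (root-unique-≤ k (^-nonneg a 0≤xy) (*-nonneg (approx-nonneg 0≤x k) (approx-nonneg 0≤y k)) (≤-reflexive powers))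
      where
      a : ℕ
      a = ⌊e* suc k ⌋
      0≤xy = *-nonneg 0≤x 0≤y
      powers : (approx x k * approx y k) ^ suc k ≈ (x * y) ^ a
      powers = trans (^-distrib-* _ _ (suc k))
        (trans (*-cong (approx-^ 0≤x k) (approx-^ 0≤y k)) (sym (^-distrib-* x y a)))

    ^ʳ-mono-≤ : ∀ {x y} → 0# ≤ x → x ≤ y → x ^ʳ e ≤ y ^ʳ e
    ^ʳ-mono-≤ {x} {y} 0≤x x≤y with x ≤? 0#
    ... | yes x≤0 = ≤-trans (≤-reflexive (^ʳ-zero (≤-antisym x≤0 0≤x))) (^ʳ-nonneg (≤-trans 0≤x x≤y))
    ... | no  x≰0 = ⪅-const (⪅-trans (λ _ → ^ʳ-nonneg 0≤y) (⪅-trans (approx-nonneg 0≤y)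
        (^ʳ⪅approx 0<x) (≤⇒⪅ λ k → root-mono-≤ k (^-nonneg ⌊e* suc k ⌋ 0≤x) (^-monoˡ-≤ ⌊e* suc k ⌋ 0≤x x≤y)))
        (approx⪅^ʳ (<-≤-trans 0<x x≤y)))
      where
      0<x = ≰⇒> x≰0
      0≤y = ≤-trans 0≤x x≤y

    ^ʳ-cong : ∀ {x y} → 0# ≤ x → x ≈ y → x ^ʳ e ≈ y ^ʳ e
    ^ʳ-cong 0≤x x≈y = ≤-antisym (^ʳ-mono-≤ 0≤x (≤-reflexive x≈y))
      (^ʳ-mono-≤ (≤-trans 0≤x (≤-reflexive x≈y)) (≤-reflexive (sym x≈y)))

    ^ʳ-distrib-* : ∀ {x y} → 0# ≤ x → 0# ≤ y → (x * y) ^ʳ e ≈ x ^ʳ e * y ^ʳ e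
    ^ʳ-distrib-* {x} {y} 0≤x 0≤y with x ≤? 0# | y ≤? 0#
    ... | yes x≤0 | _ = trans (^ʳ-zero (trans (*-congʳ x≈0) (zeroˡ y))) (sym (trans (*-congʳ (^ʳ-zero x≈0)) (zeroˡ _)))
      where x≈0 = ≤-antisym x≤0 0≤x
    ... | no _ | yes y≤0 = trans (^ʳ-zero (trans (*-congˡ y≈0) (zeroʳ x))) (sym (trans (*-congˡ (^ʳ-zero y≈0)) (zeroʳ _)))
      where y≈0 = ≤-antisym y≤0 0≤y
    ... | no x≰0 | no y≰0 = ≤-antisym
        (⪅-const (⪅-trans (λ _ → *-nonneg (^ʳ-nonneg 0≤x) (^ʳ-nonneg 0≤y))
          (⪅-trans (λ k → *-nonneg (approx-nonneg 0≤x k) (approx-nonneg 0≤y k))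
            (^ʳ⪅approx 0<xy) (≤⇒⪅ λ k → ≤-reflexive (approx-* 0≤x 0≤y k)))
          (⪅-* (approx-nonneg 0≤x) (approx-nonneg 0≤y) (λ _ → ^ʳ-nonneg 0≤x) (λ _ → ^ʳ-nonneg 0≤y)
            (approx⪅^ʳ 0<x) (approx⪅^ʳ 0<y))))
        (⪅-const (⪅-trans (λ _ → ^ʳ-nonneg 0≤xy)
          (⪅-trans (approx-nonneg 0≤xy)
            (⪅-* (λ _ → ^ʳ-nonneg 0≤x) (λ _ → ^ʳ-nonneg 0≤y) (approx-nonneg 0≤x) (approx-nonneg 0≤y)
              (^ʳ⪅approx 0<x) (^ʳ⪅approx 0<y))
            (≤⇒⪅ λ k → ≤-reflexive (sym (approx-* 0≤x 0≤y k))))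
          (approx⪅^ʳ 0<xy)))
      where
      0<x = ≰⇒> x≰0
      0<y = ≰⇒> y≰0
      0<xy = *-pos 0<x 0<y
      0≤xy = <⇒≤ 0<xy

    private
      -- The cost of replacing x = e n by its floor a is (x - a) (t - 1). It is at most t - 1 if t ≥
      -- 1 and at most 0 if t ≤ 1, so in both cases at most t.
      rounding : ∀ {a x t} → a ≤ x → x ≤ 1# + a → 0# ≤ t → x * (t - 1#) ≤ a * (t - 1#) + t
      rounding {a} {x} {t} a≤x x≤1+a 0≤t with total 1# t
      ... | inj₁ 1≤t = ≤-by ((1# + a - x) * (t - 1#) + 1#)
        (+-nonneg (*-nonneg (x≤y⇒0≤y-x x≤1+a) (x≤y⇒0≤y-x 1≤t)) 0≤1)
        (solve 3 (λ x a t → x :* (t :- :1) :+ ((:1 :+ a :- x) :* (t :- :1) :+ :1) := a :* (t :- :1) :+ t) refl x a t)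
      ... | inj₂ t≤1 = ≤-by ((x - a) * (1# - t) + t)
        (+-nonneg (*-nonneg (x≤y⇒0≤y-x a≤x) (x≤y⇒0≤y-x t≤1)) 0≤t)
        (solve 3 (λ x a t → x :* (t :- :1) :+ ((x :- a) :* (:1 :- t) :+ t) := a :* (t :- :1) :+ t) refl x a t)

    -- Let a = ⌊e n⌋ and let r be the n-th root of t ^ a. The arithmetic-geometric mean inequality
    -- for n copies of r and a - n copies of 1 gives a t ≤ n r + (a - n); here n ≤ a because e ≥ 1.
    -- Dividing by n and letting n grow turns a / n into e and r into `t ^ʳ e`. At t = 0 the left
    -- side is 1 - e ≤ 0.
    bernoulli : ∀ {t} → 1# ≤ e → 0# ≤ t → 1# + e * (t - 1#) ≤ t ^ʳ e
    bernoulli {t} 1≤e 0≤t with t ≤? 0#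
    ... | yes t≤0 = ≤-trans (≤-by (e - 1#) (x≤y⇒0≤y-x 1≤e) (trans
            (solve 2 (λ t e → :1 :+ e :* (t :- :1) :+ (e :- :1) := e :* t) refl t e)
            (trans (*-congˡ (≤-antisym t≤0 0≤t)) (zeroʳ e))))
          (^ʳ-nonneg 0≤t)
    ... | no t≰0 with K , 0≤K , r≤T ← approx⪅^ʳ (≰⇒> t≰0) =
      ≤-resp (solve 2 (λ u v → u :- v :+ v := u) refl (1# + e * (t - 1#)) T) (+-identityˡ T)
        (+-monoˡ-≤ T (bounded-multiples {v = K * T + t} multiples-bounded))
      where
      T : Carrier
      T = t ^ʳ e
      module _ (k : ℕ) where
        a b c : ℕ
        a = ⌊e* suc k ⌋
        b = suc k
        c = a ℕ.∸ b
        r : Carrier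
        r = approx t k
        b≤a : b ℕ.≤ a
        b≤a = ℕ.≤-pred (fromℕ-cancel-< {b} {suc a} (≤-<-trans
          (≤-trans (≤-reflexive (sym (*-identityˡ _))) (*-monoʳ-≤ (0≤fromℕ b) 1≤e)) (<1+⌊e*n⌋ b)))
        a≡c+b : a ≡ c ℕ.+ b
        a≡c+b = ≡.sym (ℕ.m∸n+n≡m b≤a)
        a≈c+b : fromℕ a ≈ fromℕ c + fromℕ b
        a≈c+b = trans (reflexive (≡.cong fromℕ a≡c+b)) (fromℕ-+ c b)
        at≤br+c : fromℕ a * t ≤ fromℕ b * r + fromℕ c
        at≤br+c = ^-cancelˡ-≤ a (ℕ.≤-trans (ℕ.s≤s ℕ.z≤n) b≤a)
          (+-nonneg (*-nonneg (0≤fromℕ b) (approx-nonneg 0≤t k)) (0≤fromℕ c)) (begin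
            (fromℕ a * t) ^ a               ≈⟨ ^-distrib-* (fromℕ a) t a ⟩
            fromℕ a ^ a * t ^ a             ≈⟨ *-congˡ (approx-^ 0≤t k) ⟨
            fromℕ a ^ a * r ^ b             ≤⟨ ≡.subst (λ n → fromℕ n ^ n * r ^ b ≤ (fromℕ b * r + fromℕ c) ^ n)
                                                 (≡.sym a≡c+b) (amgm b c (approx-nonneg 0≤t k)) ⟩
            (fromℕ b * r + fromℕ c) ^ a     ∎)
          where open ≤-Reasoning
        multiples-bounded : fromℕ b * (1# + e * (t - 1#) - T) ≤ K * T + t
        multiples-bounded = begin
          fromℕ b * (1# + e * (t - 1#) - T)
            ≈⟨ solve 4 (λ b e t T → b :* (:1 :+ e :* (t :- :1) :- T) := e :* b :* (t :- :1) :+ (b :- b :* T))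
                 refl (fromℕ b) e t T ⟩
          e * fromℕ b * (t - 1#) + (fromℕ b - fromℕ b * T)
            ≤⟨ +-monoˡ-≤ _ (rounding (⌊e*n⌋≤ b) (<⇒≤ (<1+⌊e*n⌋ b)) 0≤t) ⟩
          fromℕ a * (t - 1#) + t + (fromℕ b - fromℕ b * T)
            ≈⟨ solve 4 (λ a b t T → a :* (t :- :1) :+ t :+ (b :- b :* T) := a :* t :+ (t :+ (b :- b :* T) :- a))
                 refl (fromℕ a) (fromℕ b) t T ⟩
          fromℕ a * t + (t + (fromℕ b - fromℕ b * T) - fromℕ a)
            ≤⟨ +-monoˡ-≤ _ at≤br+c ⟩
          fromℕ b * r + fromℕ c + (t + (fromℕ b - fromℕ b * T) - fromℕ a)
            ≈⟨ +-congˡ (+-congˡ (-‿cong a≈c+b)) ⟩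
          fromℕ b * r + fromℕ c + (t + (fromℕ b - fromℕ b * T) - (fromℕ c + fromℕ b))
            ≈⟨ solve 5 (λ b c r t T → b :* r :+ c :+ (t :+ (b :- b :* T) :- (c :+ b)) := b :* r :+ (t :- b :* T))
                 refl (fromℕ b) (fromℕ c) r t T ⟩
          fromℕ b * r + (t - fromℕ b * T)
            ≤⟨ +-monoˡ-≤ _ (r≤T k) ⟩
          (fromℕ b + K) * T + (t - fromℕ b * T)
            ≈⟨ solve 4 (λ b K t T → (b :+ K) :* T :+ (t :- b :* T) := K :* T :+ t) refl (fromℕ b) K t T ⟩
          K * T + t ∎
          where open ≤-Reasoning

  module _ {e e′ : Carrier} (0<e : 0# < e) (0<e′ : 0# < e′) (ee′≈1 : e * e′ ≈ 1#) where
    private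
      module E = Power 0<e
      module E′ = Power 0<e′

      e*e′b≈b : ∀ b → e * (e′ * fromℕ b) ≈ fromℕ b
      e*e′b≈b b = trans (sym (*-assoc _ _ _)) (trans (*-congʳ ee′≈1) (*-identityˡ _))

    -- Take x ≥ 1 and z ^ b ≤ (x ^ʳ e) ^ a with a ≤ e′ b. Multiplying by e gives e a ≤ b, so
    -- `x ^ʳ e` is at most the a-th root of x ^ b, whence z ^ b ≤ x ^ b. For x ≤ 1 the comparisons
    -- of exponents turn round. The case a = 0 is separate because there is no root of order 0.
    ^ʳ-inverse-≤ : ∀ {x} → 0# ≤ x → (x ^ʳ e) ^ʳ e′ ≤ x
    ^ʳ-inverse-≤ {x} 0≤x = proj₂ (E′.^ʳ-isSupremum (E.^ʳ-nonneg 0≤x)) x bound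
      where
      y : Carrier
      y = x ^ʳ e
      0≤y : 0# ≤ y
      0≤y = E.^ʳ-nonneg 0≤x
      y≤root : ∀ a b → let s = root a (x ^ b) in y ≤ s → y ^ suc a ≤ x ^ b
      y≤root a b y≤s = ≤-trans (^-monoˡ-≤ (suc a) 0≤y y≤s) (≤-reflexive (proj₂ (root-spec a (^-nonneg b 0≤x))))
      bound : UpperBound (Below y e′) x
      bound z z∈ with total 1# x
      ... | inj₁ 1≤x with E′.below-1≤ (≤-trans (≤-reflexive (sym E.^ʳ-one)) (E.^ʳ-mono-≤ 0≤1 1≤x)) z∈
      ...   | zero , b , 1≤b , _ , zᵇ≤1 = ^-cancelˡ-≤ b 1≤b 0≤x (≤-trans zᵇ≤1 (1≤x^n b 1≤x))
      ...   | suc a , b , 1≤b , a≤e′b , zᵇ≤yᵃ = ^-cancelˡ-≤ b 1≤b 0≤x (≤-trans zᵇ≤yᵃ (y≤root a b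
        (E.^ʳ-upper-1≤ b (suc a) (ℕ.s≤s ℕ.z≤n) 1≤x (proj₁ (root-spec a (^-nonneg b 0≤x)))
          (≤-resp refl (e*e′b≈b b) (*-monoˡ-≤ (<⇒≤ 0<e) a≤e′b))
          (≤-reflexive (sym (proj₂ (root-spec a (^-nonneg b 0≤x))))))))
      bound z z∈ | inj₂ x≤1 with E′.below-≤1 0≤y (≤-trans (E.^ʳ-mono-≤ 0≤x x≤1) (≤-reflexive E.^ʳ-one)) z∈
      ...   | zero , suc b , _ , e′b≤0 , _ = contradiction e′b≤0 (<⇒≱ (*-pos 0<e′ (0<fromℕ b)))
      ...   | suc a , b , 1≤b , e′b≤a , zᵇ≤yᵃ = ^-cancelˡ-≤ b 1≤b 0≤x (≤-trans zᵇ≤yᵃ (y≤root a b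
        (E.^ʳ-upper-≤1 b (suc a) (ℕ.s≤s ℕ.z≤n) 0≤x x≤1 (proj₁ (root-spec a (^-nonneg b 0≤x)))
          (≤-resp (e*e′b≈b b) refl (*-monoˡ-≤ (<⇒≤ 0<e) e′b≤a))
          (≤-reflexive (sym (proj₂ (root-spec a (^-nonneg b 0≤x))))))))

    ^ʳ-inverse-≥ : ∀ {x} → 0# ≤ x → x ≤ (x ^ʳ e) ^ʳ e′
    ^ʳ-inverse-≥ {x} 0≤x with x ≤? 0#
    ... | yes x≤0 = ≤-trans x≤0 (E′.^ʳ-nonneg (E.^ʳ-nonneg 0≤x))
    -- φ x = (x ^ʳ e) ^ʳ e′ is multiplicative with φ x⁻¹ ≤ x⁻¹, so 1 = φ x φ x⁻¹ ≤ φ x x⁻¹.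
    ... | no  x≰0 = *-cancelˡ-≤ (0<x⁻¹ 0<x) (begin
        x ⁻¹ * x                                     ≈⟨ x⁻¹*x≈1 0<x ⟩
        1#                                           ≈⟨ E′.^ʳ-one ⟨
        1# ^ʳ e′                                     ≈⟨ E′.^ʳ-cong (E.^ʳ-nonneg 0≤1) E.^ʳ-one ⟨
        (1# ^ʳ e) ^ʳ e′                              ≈⟨ E′.^ʳ-cong (E.^ʳ-nonneg 0≤1) (E.^ʳ-cong 0≤1 (sym (x⁻¹*x≈1 0<x))) ⟩
        ((x ⁻¹ * x) ^ʳ e) ^ʳ e′                      ≈⟨ E′.^ʳ-cong (E.^ʳ-nonneg (*-nonneg 0≤x⁻¹ 0≤x)) (E.^ʳ-distrib-* 0≤x⁻¹ 0≤x) ⟩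
        ((x ⁻¹) ^ʳ e * x ^ʳ e) ^ʳ e′                 ≈⟨ E′.^ʳ-distrib-* (E.^ʳ-nonneg 0≤x⁻¹) (E.^ʳ-nonneg 0≤x) ⟩
        ((x ⁻¹) ^ʳ e) ^ʳ e′ * (x ^ʳ e) ^ʳ e′         ≤⟨ *-monoʳ-≤ (E′.^ʳ-nonneg (E.^ʳ-nonneg 0≤x)) (^ʳ-inverse-≤ 0≤x⁻¹) ⟩
        x ⁻¹ * (x ^ʳ e) ^ʳ e′                        ∎)
      where
      open ≤-Reasoning
      0<x = ≰⇒> x≰0
      0≤x⁻¹ = <⇒≤ (0<x⁻¹ 0<x)

-- Absolute values and the triangle inequality for all p-norms

module Norms (ℝ : RealNumbers) where
  open RealPowers ℝ public
  open Discrepancy ℝ using (abs; sum; Exponent; finite; ∞; norm; norm₁) public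
  open MaxOp (maxOperator totalOrder) using (x≤x⊔y; x≤y⊔x; ⊔-lub)

  x≤∣x∣ : ∀ x → x ≤ abs x
  x≤∣x∣ x = x≤x⊔y x (- x)

  -x≤∣x∣ : ∀ x → - x ≤ abs x
  -x≤∣x∣ x = x≤y⊔x x (- x)

  ∣x∣-lub : ∀ {x y} → x ≤ y → - x ≤ y → abs x ≤ y
  ∣x∣-lub = ⊔-lub

  0≤∣x∣ : ∀ x → 0# ≤ abs x
  0≤∣x∣ x with total 0# x
  ... | inj₁ 0≤x = ≤-trans 0≤x (x≤∣x∣ x)
  ... | inj₂ x≤0 = ≤-trans (≤-resp (-‿inverseʳ x) (+-identityˡ (- x)) (+-monoˡ-≤ (- x) x≤0)) (-x≤∣x∣ x)

  ∣x∣-cong : ∀ {x y} → x ≈ y → abs x ≈ abs y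
  ∣x∣-cong x≈y = ≤-antisym (le x≈y) (le (sym x≈y))
    where
    le : ∀ {x y} → x ≈ y → abs x ≤ abs y
    le {x} {y} x≈y = ∣x∣-lub (≤-trans (≤-reflexive x≈y) (x≤∣x∣ y)) (≤-trans (≤-reflexive (-‿cong x≈y)) (-x≤∣x∣ y))

  nonneg⇒∣x∣≈x : ∀ {x} → 0# ≤ x → abs x ≈ x
  nonneg⇒∣x∣≈x {x} 0≤x = ≤-antisym
    (∣x∣-lub ≤-refl (≤-by (x + x) (+-nonneg 0≤x 0≤x) (solve 1 (λ x → :- x :+ (x :+ x) := x) refl x))) (x≤∣x∣ x)

  ∣-x∣≈∣x∣ : ∀ x → abs (- x) ≈ abs x
  ∣-x∣≈∣x∣ x = ≤-antisym
    (∣x∣-lub (-x≤∣x∣ x) (≤-trans (≤-reflexive (solve 1 (λ x → :- (:- x) := x) refl x)) (x≤∣x∣ x)))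
    (∣x∣-lub (≤-trans (≤-reflexive (solve 1 (λ x → x := :- (:- x)) refl x)) (-x≤∣x∣ (- x))) (x≤∣x∣ (- x)))

  ∣x+y∣≤∣x∣+∣y∣ : ∀ x y → abs (x + y) ≤ abs x + abs y
  ∣x+y∣≤∣x∣+∣y∣ x y = ∣x∣-lub (+-mono-≤ (x≤∣x∣ x) (x≤∣x∣ y))
    (≤-trans (≤-reflexive (solve 2 (λ x y → :- (x :+ y) := :- x :- y) refl x y)) (+-mono-≤ (-x≤∣x∣ x) (-x≤∣x∣ y)))

  ≤-limit : ∀ {x y} → (∀ k → x ≤ y + (fromℕ (suc k)) ⁻¹) → x ≤ y
  ≤-limit {x} {y} x≤y+1/n = ≤-resp (solve 2 (λ x y → x :- y :+ y := x) refl x y) (+-identityˡ y)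
    (+-monoˡ-≤ y (bounded-multiples {v = 1#} λ k →
      let n = fromℕ (suc k) in
      ≤-resp refl (x*x⁻¹≈1 (0<fromℕ k)) (*-monoˡ-≤ (0≤fromℕ (suc k))
        (≤-resp refl (solve 2 (λ y z → y :+ z :- y := z) refl y (n ⁻¹)) (+-monoˡ-≤ (- y) (x≤y+1/n k))))))

  -- Bernoulli's inequality is applied to the ratios t, t′ of x / a and y / b to their mean D.
  convexity : ∀ {e a b x y} (0<e : 0# < e) → 1# ≤ e → 0# < a → 0# < b → 0# ≤ x → 0# ≤ y →
              (a + b) * ((x + y) * (a + b) ⁻¹) ^ʳ e ≤ a * (x * a ⁻¹) ^ʳ e + b * (y * b ⁻¹) ^ʳ e
  convexity {e} {a} {b} {x} {y} 0<e 1≤e 0<a 0<b 0≤x 0≤y with x + y ≤? 0#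
  ... | yes x+y≤0 = ≤-trans
      (≤-reflexive (trans (*-congˡ (^ʳ-zero (trans (*-congʳ (≤-antisym x+y≤0 (+-nonneg 0≤x 0≤y))) (zeroˡ _)))) (zeroʳ _)))
      (+-nonneg (*-nonneg (<⇒≤ 0<a) (^ʳ-nonneg (*-nonneg 0≤x (<⇒≤ (0<x⁻¹ 0<a)))))
                (*-nonneg (<⇒≤ 0<b) (^ʳ-nonneg (*-nonneg 0≤y (<⇒≤ (0<x⁻¹ 0<b))))))
    where open Power 0<e
  ... | no x+y≰0 = begin
      (a + b) * D ^ʳ e
        -- The inserted term is 0. As D is the mean of x / a and y / b with weights a and b, a t + b
        -- t′ = a + b, so the corrections a (t - 1) and b (t′ - 1) cancel and each half can take its
        -- own tangent term.
        ≈⟨ solve 4 (λ a b e P → (a :+ b) :* P := P :* (a :+ b :+ e :* (a :+ b :- (a :+ b)))) refl a b e (D ^ʳ e) ⟩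
      D ^ʳ e * (a + b + e * (a + b - (a + b)))
        ≈⟨ *-congˡ (+-congˡ (*-congˡ (+-congʳ (sym at+bt′≈a+b)))) ⟩
      D ^ʳ e * (a + b + e * (a * t + b * t′ - (a + b)))
        ≈⟨ solve 6 (λ a b e P t t′ → P :* (a :+ b :+ e :* (a :* t :+ b :* t′ :- (a :+ b)))
             := a :* (P :* (:1 :+ e :* (t :- :1))) :+ b :* (P :* (:1 :+ e :* (t′ :- :1)))) refl a b e (D ^ʳ e) t t′ ⟩
      a * (D ^ʳ e * (1# + e * (t - 1#))) + b * (D ^ʳ e * (1# + e * (t′ - 1#)))
        ≤⟨ +-mono-≤ (*-monoˡ-≤ (<⇒≤ 0<a) (*-monoˡ-≤ (^ʳ-nonneg 0≤D) (bernoulli 1≤e 0≤t)))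
                    (*-monoˡ-≤ (<⇒≤ 0<b) (*-monoˡ-≤ (^ʳ-nonneg 0≤D) (bernoulli 1≤e 0≤t′))) ⟩
      a * (D ^ʳ e * t ^ʳ e) + b * (D ^ʳ e * t′ ^ʳ e)
        ≈⟨ +-cong (*-congˡ (trans (sym (^ʳ-distrib-* 0≤D 0≤t)) (^ʳ-cong (*-nonneg 0≤D 0≤t) (D*[z/D]≈z _))))
                  (*-congˡ (trans (sym (^ʳ-distrib-* 0≤D 0≤t′)) (^ʳ-cong (*-nonneg 0≤D 0≤t′) (D*[z/D]≈z _)))) ⟩
      a * (x * a ⁻¹) ^ʳ e + b * (y * b ⁻¹) ^ʳ e ∎
    where
    open Power 0<e
    open ≤-Reasoning
    0<a+b : 0# < a + b
    0<a+b = +-pos-nonneg 0<a (<⇒≤ 0<b)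
    D t t′ : Carrier
    D = (x + y) * (a + b) ⁻¹
    t = x * a ⁻¹ * D ⁻¹
    t′ = y * b ⁻¹ * D ⁻¹
    0<D : 0# < D
    0<D = *-pos (≰⇒> x+y≰0) (0<x⁻¹ 0<a+b)
    0≤D = <⇒≤ 0<D
    0≤D⁻¹ = <⇒≤ (0<x⁻¹ 0<D)
    0≤t : 0# ≤ t
    0≤t = *-nonneg (*-nonneg 0≤x (<⇒≤ (0<x⁻¹ 0<a))) 0≤D⁻¹
    0≤t′ : 0# ≤ t′
    0≤t′ = *-nonneg (*-nonneg 0≤y (<⇒≤ (0<x⁻¹ 0<b))) 0≤D⁻¹
    D*[z/D]≈z : ∀ z → D * (z * D ⁻¹) ≈ z
    D*[z/D]≈z z = Division.y*[x/y]≈x z 0<D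
    a*[z/a*w]≈z*w : ∀ {a} z w → 0# < a → a * (z * a ⁻¹ * w) ≈ z * w
    a*[z/a*w]≈z*w {a} z w 0<a = trans (sym (*-assoc _ _ _)) (*-congʳ (Division.y*[x/y]≈x z 0<a))
    at+bt′≈a+b : a * t + b * t′ ≈ a + b
    at+bt′≈a+b = begin-equality
      a * t + b * t′                         ≈⟨ +-cong (a*[z/a*w]≈z*w x _ 0<a) (a*[z/a*w]≈z*w y _ 0<b) ⟩
      x * D ⁻¹ + y * D ⁻¹                    ≈⟨ distribʳ _ _ _ ⟨
      (x + y) * D ⁻¹                         ≈⟨ *-congʳ (Division.y*[x/y]≈x (x + y) 0<a+b) ⟨
      (a + b) * D * D ⁻¹                     ≈⟨ *-assoc _ _ _ ⟩
      (a + b) * (D * D ⁻¹)                   ≈⟨ *-congˡ (x*x⁻¹≈1 0<D) ⟩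
      (a + b) * 1#                           ≈⟨ *-identityʳ _ ⟩
      a + b                                  ∎

  ∞-norm-lub : ∀ {n} (v : Vec Carrier n) {c} → 0# ≤ c → (∀ i → abs (lookup v i) ≤ c) → norm ∞ v ≤ c
  ∞-norm-lub []      0≤c v≤c = 0≤c
  ∞-norm-lub (x ∷ v) 0≤c v≤c = ⊔-lub (v≤c zero) (∞-norm-lub v 0≤c (λ i → v≤c (suc i)))

  ∣vᵢ∣≤∞-norm : ∀ {n} (v : Vec Carrier n) i → abs (lookup v i) ≤ norm ∞ v
  ∣vᵢ∣≤∞-norm (x ∷ v) zero    = x≤x⊔y _ _
  ∣vᵢ∣≤∞-norm (x ∷ v) (suc i) = ≤-trans (∣vᵢ∣≤∞-norm v i) (x≤y⊔x (abs x) _)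

  0≤∞-norm : ∀ {n} (v : Vec Carrier n) → 0# ≤ norm ∞ v
  0≤∞-norm []      = ≤-refl
  0≤∞-norm (x ∷ v) = ≤-trans (0≤∣x∣ x) (x≤x⊔y _ _)

  -- Minkowski's inequality for finite p

  module FiniteNorm {p : Carrier} (1≤p : 1# ≤ p) where
    private
      0<p : 0# < p
      0<p = <-≤-trans 0<1 1≤p
      0<p⁻¹ : 0# < p ⁻¹
      0<p⁻¹ = 0<x⁻¹ 0<p
      module P = Power 0<p
      module R = Power 0<p⁻¹

    powerSum : ∀ {n} → Vec Carrier n → Carrier
    powerSum v = sum (Vec.map (λ x → abs x ^ʳ p) v)

    powerSum-nonneg : ∀ {n} (v : Vec Carrier n) → 0# ≤ powerSum v
    powerSum-nonneg []      = ≤-refl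
    powerSum-nonneg (x ∷ v) = +-nonneg (P.^ʳ-nonneg (0≤∣x∣ x)) (powerSum-nonneg v)

    powerSum-mono-≤ : ∀ {n} (u v : Vec Carrier n) → (∀ i → abs (lookup u i) ≤ abs (lookup v i)) →
                      powerSum u ≤ powerSum v
    powerSum-mono-≤ []      []      u≤v = ≤-refl
    powerSum-mono-≤ (x ∷ u) (y ∷ v) u≤v =
      +-mono-≤ (P.^ʳ-mono-≤ (0≤∣x∣ x) (u≤v zero)) (powerSum-mono-≤ u v (λ i → u≤v (suc i)))

    powerSum-zero : ∀ {n} (v : Vec Carrier n) → (∀ i → lookup v i ≈ 0#) → powerSum v ≈ 0#
    powerSum-zero []      v≈0 = refl
    powerSum-zero (x ∷ v) v≈0 = trans
      (+-cong (P.^ʳ-zero (trans (∣x∣-cong (v≈0 zero)) (nonneg⇒∣x∣≈x ≤-refl))) (powerSum-zero v (λ i → v≈0 (suc i))))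
      (+-identityʳ 0#)

    -- `convexity` is used in every coordinate with the same a and b, which later bound the two
    -- norms. The factor `a ⁻¹ ^ʳ p` is therefore common to all coordinates and comes out of the
    -- sum.
    powerSum-convex : ∀ {n a b} (u v : Vec Carrier n) → 0# < a → 0# < b →
                      (a + b) * ((a + b) ⁻¹ ^ʳ p * powerSum (zipWith _+_ u v)) ≤
                      a * (a ⁻¹ ^ʳ p * powerSum u) + b * (b ⁻¹ ^ʳ p * powerSum v)
    powerSum-convex {a = a} {b} [] [] 0<a 0<b = ≤-reflexive (solve 6
      (λ a b c A B C → c :* (C :* :0) := a :* (A :* :0) :+ b :* (B :* :0)) refl
      a b (a + b) (a ⁻¹ ^ʳ p) (b ⁻¹ ^ʳ p) ((a + b) ⁻¹ ^ʳ p))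
    powerSum-convex {a = a} {b} (x ∷ u) (y ∷ v) 0<a 0<b = begin
      (a + b) * (C * (abs (x + y) ^ʳ p + powerSum (zipWith _+_ u v)))
        ≈⟨ solve 4 (λ c C z S → c :* (C :* (z :+ S)) := c :* (z :* C) :+ c :* (C :* S)) refl
             (a + b) C (abs (x + y) ^ʳ p) (powerSum (zipWith _+_ u v)) ⟩
      (a + b) * (abs (x + y) ^ʳ p * C) + (a + b) * (C * powerSum (zipWith _+_ u v))
        ≤⟨ +-mono-≤ head (powerSum-convex u v 0<a 0<b) ⟩
      a * (abs x ^ʳ p * A) + b * (abs y ^ʳ p * B) + (a * (A * powerSum u) + b * (B * powerSum v))
        ≈⟨ +-cong (+-cong (*-congˡ (*-comm _ _)) (*-congˡ (*-comm _ _))) refl ⟩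
      a * (A * abs x ^ʳ p) + b * (B * abs y ^ʳ p) + (a * (A * powerSum u) + b * (B * powerSum v))
        ≈⟨ solve 8 (λ a b A B x y S T → a :* (A :* x) :+ b :* (B :* y) :+ (a :* (A :* S) :+ b :* (B :* T))
             := a :* (A :* (x :+ S)) :+ b :* (B :* (y :+ T))) refl
             a b A B (abs x ^ʳ p) (abs y ^ʳ p) (powerSum u) (powerSum v) ⟩
      a * (A * (abs x ^ʳ p + powerSum u)) + b * (B * (abs y ^ʳ p + powerSum v)) ∎
      where
      open ≤-Reasoning
      A B C : Carrier
      A = a ⁻¹ ^ʳ p
      B = b ⁻¹ ^ʳ p
      C = (a + b) ⁻¹ ^ʳ p
      0≤inverse : ∀ {z} → 0# < z → 0# ≤ z ⁻¹
      0≤inverse 0<z = <⇒≤ (0<x⁻¹ 0<z)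
      0≤[a+b]⁻¹ : 0# ≤ (a + b) ⁻¹
      0≤[a+b]⁻¹ = 0≤inverse (+-pos-nonneg 0<a (<⇒≤ 0<b))
      head : (a + b) * (abs (x + y) ^ʳ p * C) ≤ a * (abs x ^ʳ p * A) + b * (abs y ^ʳ p * B)
      head = begin
        (a + b) * (abs (x + y) ^ʳ p * C)
          ≈⟨ *-congˡ (P.^ʳ-distrib-* (0≤∣x∣ _) 0≤[a+b]⁻¹) ⟨
        (a + b) * (abs (x + y) * (a + b) ⁻¹) ^ʳ p
          ≤⟨ *-monoˡ-≤ (<⇒≤ (+-pos-nonneg 0<a (<⇒≤ 0<b))) (P.^ʳ-mono-≤ (*-nonneg (0≤∣x∣ _) 0≤[a+b]⁻¹)
               (*-monoʳ-≤ 0≤[a+b]⁻¹ (∣x+y∣≤∣x∣+∣y∣ x y))) ⟩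
        (a + b) * ((abs x + abs y) * (a + b) ⁻¹) ^ʳ p
          ≤⟨ convexity 0<p 1≤p 0<a 0<b (0≤∣x∣ x) (0≤∣x∣ y) ⟩
        a * (abs x * a ⁻¹) ^ʳ p + b * (abs y * b ⁻¹) ^ʳ p
          ≈⟨ +-cong (*-congˡ (P.^ʳ-distrib-* (0≤∣x∣ x) (0≤inverse 0<a))) (*-congˡ (P.^ʳ-distrib-* (0≤∣x∣ y) (0≤inverse 0<b))) ⟩
        a * (abs x ^ʳ p * A) + b * (abs y ^ʳ p * B) ∎

    private
      a⁻¹ᵖaᵖ≈1 : ∀ {a} → 0# < a → a ⁻¹ ^ʳ p * a ^ʳ p ≈ 1#
      a⁻¹ᵖaᵖ≈1 0<a = trans (sym (P.^ʳ-distrib-* (<⇒≤ (0<x⁻¹ 0<a)) (<⇒≤ 0<a)))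
        (trans (P.^ʳ-cong (*-nonneg (<⇒≤ (0<x⁻¹ 0<a)) (<⇒≤ 0<a)) (x⁻¹*x≈1 0<a)) P.^ʳ-one)

      scaled-≤1 : ∀ {a S} → 0# < a → S ≤ a ^ʳ p → a ⁻¹ ^ʳ p * S ≤ 1#
      scaled-≤1 0<a S≤aᵖ = ≤-trans (*-monoˡ-≤ (P.^ʳ-nonneg (<⇒≤ (0<x⁻¹ 0<a))) S≤aᵖ) (≤-reflexive (a⁻¹ᵖaᵖ≈1 0<a))

    -- Dividing u by a and v by b puts both into the unit ball. The vector (u + v) / (a + b) is
    -- their combination with weights a / (a + b) and b / (a + b), so convexity keeps it there.
    minkowski-bound : ∀ {n a b} (u v : Vec Carrier n) → 0# < a → 0# < b →
                      powerSum u ≤ a ^ʳ p → powerSum v ≤ b ^ʳ p →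
                      powerSum (zipWith _+_ u v) ≤ (a + b) ^ʳ p
    minkowski-bound {a = a} {b} u v 0<a 0<b u≤a v≤b =
      *-cancelˡ-≤ 0<C (≤-resp refl (sym (a⁻¹ᵖaᵖ≈1 0<a+b)) (*-cancelˡ-≤ 0<a+b (begin
        (a + b) * (C * powerSum (zipWith _+_ u v))
          ≤⟨ powerSum-convex u v 0<a 0<b ⟩
        a * (a ⁻¹ ^ʳ p * powerSum u) + b * (b ⁻¹ ^ʳ p * powerSum v)
          ≤⟨ +-mono-≤ (*-monoˡ-≤ (<⇒≤ 0<a) (scaled-≤1 0<a u≤a)) (*-monoˡ-≤ (<⇒≤ 0<b) (scaled-≤1 0<b v≤b)) ⟩
        a * 1# + b * 1#
          ≈⟨ distribʳ _ _ _ ⟨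
        (a + b) * 1# ∎)))
      where
      open ≤-Reasoning
      0<a+b : 0# < a + b
      0<a+b = +-pos-nonneg 0<a (<⇒≤ 0<b)
      C : Carrier
      C = (a + b) ⁻¹ ^ʳ p
      0<C : 0# < C
      0<C = ≰⇒> λ C≤0 → <⇒≱ 0<1 (≤-resp (a⁻¹ᵖaᵖ≈1 0<a+b) (zeroˡ _)
        (*-monoʳ-≤ (P.^ʳ-nonneg (<⇒≤ 0<a+b)) C≤0))

    finiteNorm : ∀ {n} → Vec Carrier n → Carrier
    finiteNorm = norm (finite p 1≤p)

    finiteNorm-nonneg : ∀ {n} (v : Vec Carrier n) → 0# ≤ finiteNorm v
    finiteNorm-nonneg v = R.^ʳ-nonneg (powerSum-nonneg v)

    finiteNorm-mono-≤ : ∀ {n} (u v : Vec Carrier n) → (∀ i → abs (lookup u i) ≤ abs (lookup v i)) →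
                        finiteNorm u ≤ finiteNorm v
    finiteNorm-mono-≤ u v u≤v = R.^ʳ-mono-≤ (powerSum-nonneg u) (powerSum-mono-≤ u v u≤v)

    finiteNorm-zero : ∀ {n} (v : Vec Carrier n) → (∀ i → lookup v i ≈ 0#) → finiteNorm v ≈ 0#
    finiteNorm-zero v v≈0 = R.^ʳ-zero (powerSum-zero v v≈0)

    -- The norms are enlarged by δ, ε > 0 because minkowski-bound divides by its bounds.
    finiteNorm-triangle : ∀ {n} (u v : Vec Carrier n) →
                          finiteNorm (zipWith _+_ u v) ≤ finiteNorm u + finiteNorm v
    finiteNorm-triangle u v = ≤-limit λ k → ≤-limit λ l → ≤-trans (bound (0<x⁻¹ (0<fromℕ k)) (0<x⁻¹ (0<fromℕ l)))
      (≤-reflexive (solve 4 (λ x δ y ε → x :+ δ :+ (y :+ ε) := x :+ y :+ δ :+ ε) refl (finiteNorm u) _ (finiteNorm v) _))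
      where
      powerSum≤ : ∀ {n ε} (w : Vec Carrier n) → 0# < ε → powerSum w ≤ (finiteNorm w + ε) ^ʳ p
      powerSum≤ w 0<ε = ≤-trans (^ʳ-inverse-≥ 0<p⁻¹ 0<p (x⁻¹*x≈1 0<p) (powerSum-nonneg w))
        (P.^ʳ-mono-≤ (finiteNorm-nonneg w) (≤-by _ (<⇒≤ 0<ε) refl))
      0<norm+ε : ∀ {n ε} (w : Vec Carrier n) → 0# < ε → 0# < finiteNorm w + ε
      0<norm+ε w 0<ε = <-≤-trans 0<ε (≤-by _ (finiteNorm-nonneg w) (+-comm _ _))
      bound : ∀ {δ ε} → 0# < δ → 0# < ε →
              finiteNorm (zipWith _+_ u v) ≤ finiteNorm u + δ + (finiteNorm v + ε)
      bound {δ} {ε} 0<δ 0<ε = ≤-trans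
        (R.^ʳ-mono-≤ (powerSum-nonneg (zipWith _+_ u v))
          (minkowski-bound u v (0<norm+ε u 0<δ) (0<norm+ε v 0<ε) (powerSum≤ u 0<δ) (powerSum≤ v 0<ε)))
        (^ʳ-inverse-≤ 0<p 0<p⁻¹ (x*x⁻¹≈1 0<p) (+-nonneg (<⇒≤ (0<norm+ε u 0<δ)) (<⇒≤ (0<norm+ε v 0<ε))))

  norm-nonneg : ∀ p {n} (v : Vec Carrier n) → 0# ≤ norm p v
  norm-nonneg (finite _ 1≤p) = FiniteNorm.finiteNorm-nonneg 1≤p
  norm-nonneg ∞              = 0≤∞-norm

  norm-mono-≤ : ∀ p {n} (u v : Vec Carrier n) → (∀ i → abs (lookup u i) ≤ abs (lookup v i)) → norm p u ≤ norm p v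
  norm-mono-≤ (finite _ 1≤p) u v u≤v = FiniteNorm.finiteNorm-mono-≤ 1≤p u v u≤v
  norm-mono-≤ ∞              u v u≤v = ∞-norm-lub u (0≤∞-norm v) λ i → ≤-trans (u≤v i) (∣vᵢ∣≤∞-norm v i)

  norm-cong-≤ : ∀ p {n} (u v : Vec Carrier n) → (∀ i → lookup u i ≈ lookup v i) → norm p u ≤ norm p v
  norm-cong-≤ p u v u≈v = norm-mono-≤ p u v λ i → ≤-reflexive (∣x∣-cong (u≈v i))

  norm-zero : ∀ p {n} (v : Vec Carrier n) → (∀ i → lookup v i ≈ 0#) → norm p v ≤ 0#
  norm-zero (finite _ 1≤p) v v≈0 = ≤-reflexive (FiniteNorm.finiteNorm-zero 1≤p v v≈0)
  norm-zero ∞              v v≈0 = ∞-norm-lub v ≤-refl λ i →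
    ≤-reflexive (trans (∣x∣-cong (v≈0 i)) (nonneg⇒∣x∣≈x ≤-refl))

  norm-triangle : ∀ p {n} (u v : Vec Carrier n) → norm p (zipWith _+_ u v) ≤ norm p u + norm p v
  norm-triangle (finite _ 1≤p) u v = FiniteNorm.finiteNorm-triangle 1≤p u v
  norm-triangle ∞              u v = ∞-norm-lub (zipWith _+_ u v) (+-nonneg (0≤∞-norm u) (0≤∞-norm v)) λ i →
    ≡.subst (λ x → abs x ≤ _) (≡.sym (Vec.lookup-zipWith _+_ i u v))
      (≤-trans (∣x+y∣≤∣x∣+∣y∣ _ _) (+-mono-≤ (∣vᵢ∣≤∞-norm u i) (∣vᵢ∣≤∞-norm v i)))

-- Discrepancy as an attained minimum, duplicate rows, one round of colouring

module PartialColourings (ℝ : RealNumbers) where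
  open Norms ℝ public
  open Discrepancy ℝ using
    (Matrix; _*ᵥ_; select; columns; distinctRows; allVecs; colourings; subsets; disc; Duplicates; kept; removed;
     discOn; herdisc; maxDiscUpTo; partialSum; HasSum) public
  open Extrema totalOrder using (argmin-sel; min≤v⁺; v≤min⁺; v≤max⁺; max≤v⁺; ⊥≤max)

  fromℕ<1 : ∀ {k} → fromℕ k < 1# → k ≡ 0
  fromℕ<1 {zero}  _   = ≡.refl
  fromℕ<1 {suc k} k<1 = contradiction (≤-by (fromℕ k) (0≤fromℕ k) refl) (<⇒≱ k<1)

  ∈-allVecs⁺ : ∀ {X : Set} {xs : List X} {n} {v : Vec X n} → All (_∈ xs) v → v ∈ allVecs xs n
  ∈-allVecs⁺ []           = here ≡.refl
  ∈-allVecs⁺ (x∈xs ∷ v⊆xs) = ∈-cartesianProductWith⁺ _∷_ x∈xs (∈-allVecs⁺ v⊆xs)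

  ∈-allVecs⁻ : ∀ {X : Set} (xs : List X) {n} {v : Vec X n} → v ∈ allVecs xs n → All (_∈ xs) v
  ∈-allVecs⁻ xs {zero}  {[]} _ = []
  ∈-allVecs⁻ xs {suc n} v∈ with _ , _ , x∈xs , v∈′ , ≡.refl ← ∈-cartesianProductWith⁻ _∷_ xs (allVecs xs n) v∈ =
    x∈xs ∷ ∈-allVecs⁻ xs v∈′

  dot : ∀ {n} → Vec Carrier n → Vec Carrier n → Carrier
  dot r x = sum (zipWith _*_ r x)

  lookup-*ᵥ : ∀ {m k} (B : Matrix m k) x i → lookup (B *ᵥ x) i ≡ dot (lookup B i) x
  lookup-*ᵥ B x i = Vec.lookup-map i (λ r → dot r x) B

  dot-cong : ∀ {n} (r s x y : Vec Carrier n) → Pointwise _≈_ r s → Pointwise _≈_ x y → dot r x ≈ dot s y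
  dot-cong []      []      []      []      []            []            = refl
  dot-cong (_ ∷ r) (_ ∷ s) (_ ∷ x) (_ ∷ y) (r≈s ∷ rs≈ss) (x≈y ∷ xs≈ys) =
    +-cong (*-cong r≈s x≈y) (dot-cong r s x y rs≈ss xs≈ys)

  dot-empty : ∀ {k} (r x : Vec Carrier k) → k ≡ 0 → dot r x ≈ 0#
  dot-empty [] [] ≡.refl = refl

  norm-*ᵥ-≤ : ∀ p {m k l} (B : Matrix m k) (C : Matrix m l) x y →
              (∀ i → dot (lookup B i) x ≈ dot (lookup C i) y) → norm p (B *ᵥ x) ≤ norm p (C *ᵥ y)
  norm-*ᵥ-≤ p B C x y Bx≈Cy = norm-cong-≤ p (B *ᵥ x) (C *ᵥ y) λ i →
    ≡.subst₂ _≈_ (≡.sym (lookup-*ᵥ B x i)) (≡.sym (lookup-*ᵥ C y i)) (Bx≈Cy i)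

  Unit Ternary : Carrier → Set
  Unit c = c ≈ 1# ⊎ c ≈ - 1#
  Ternary c = c ≈ 0# ⊎ Unit c

  unit⇒∣c∣≈1 : ∀ {c} → Unit c → abs c ≈ 1#
  unit⇒∣c∣≈1 (inj₁ c≈1)  = trans (∣x∣-cong c≈1) (nonneg⇒∣x∣≈x 0≤1)
  unit⇒∣c∣≈1 (inj₂ c≈-1) = trans (∣x∣-cong c≈-1) (trans (∣-x∣≈∣x∣ 1#) (nonneg⇒∣x∣≈x 0≤1))

  units⇒norm₁≈k : ∀ {k} {x : Vec Carrier k} → All Unit x → norm₁ x ≈ fromℕ k
  units⇒norm₁≈k []       = refl
  units⇒norm₁≈k (c ∷ cs) = +-cong (unit⇒∣c∣≈1 c) (units⇒norm₁≈k cs)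

  ones : ∀ k → All Unit (replicate k 1#)
  ones zero    = []
  ones (suc k) = inj₁ refl ∷ ones k

  signs : List Carrier
  signs = 0# ∷ 1# ∷ - 1# ∷ []

  sign⇒ternary : ∀ {c} → c ∈ signs → Ternary c
  sign⇒ternary (here ≡.refl)                 = inj₁ refl
  sign⇒ternary (there (here ≡.refl))         = inj₂ (inj₁ refl)
  sign⇒ternary (there (there (here ≡.refl))) = inj₂ (inj₂ refl)

  unit⇒sign : ∀ {c} → Unit c → ∃ λ c′ → c′ ∈ signs × c′ ≈ c × Unit c′
  unit⇒sign (inj₁ c≈1)  = 1# , there (here ≡.refl) , sym c≈1 , inj₁ refl
  unit⇒sign (inj₂ c≈-1) = - 1# , there (there (here ≡.refl)) , sym c≈-1 , inj₂ refl

  -- Membership in `colourings` is propositional and its entries are literal signs, so a vector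
  -- whose entries are only ≈-equal to signs must first be replaced by a literal one.
  units⇒colouring : ∀ {k} {x : Vec Carrier k} → All Unit x →
                    Σ[ x′ ∈ Vec Carrier k ] All (_∈ signs) x′ × Pointwise _≈_ x′ x × All Unit x′
  units⇒colouring []       = [] , [] , [] , []
  units⇒colouring (c ∷ cs) =
    let c′ , c′∈ , c′≈c , u = unit⇒sign c
        cs′ , cs′∈ , cs′≈cs , us = units⇒colouring cs
    in c′ ∷ cs′ , c′∈ ∷ cs′∈ , c′≈c ∷ cs′≈cs , u ∷ us

  admissible : Carrier → ∀ k → List (Vec Carrier k)
  admissible α k = List.filter (λ x → α * fromℕ k ≤? norm₁ x) (colourings k)

  module _ (p : Exponent) (α : Carrier) {m k} (B : Matrix m k) where
    private
      norms : List Carrier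
      norms = List.map (λ x → norm p (B *ᵥ x)) (admissible α k)

    disc≤ones : disc p α B ≤ norm p (B *ᵥ replicate k 1#)
    disc≤ones = min≤v⁺ (norm p (B *ᵥ replicate k 1#)) norms (inj₁ ≤-refl)

    disc≤admissible : ∀ {x} → x ∈ admissible α k → disc p α B ≤ norm p (B *ᵥ x)
    disc≤admissible x∈ = min≤v⁺ (norm p (B *ᵥ replicate k 1#)) norms
      (inj₂ (lose (∈-map⁺ (λ x → norm p (B *ᵥ x)) x∈) ≤-refl))

    disc-glb : ∀ {c} → (∀ x → c ≤ norm p (B *ᵥ x)) → c ≤ disc p α B
    disc-glb c≤ = v≤min⁺ {xs = norms} (c≤ (replicate k 1#)) (ListAll.map⁺ (ListAll.universal c≤ (admissible α k)))

    disc-nonneg : 0# ≤ disc p α B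
    disc-nonneg = disc-glb λ x → norm-nonneg p (B *ᵥ x)

    disc-attained : α ≤ 1# → ∃ λ x → All Ternary x × α * fromℕ k ≤ norm₁ x × norm p (B *ᵥ x) ≤ disc p α B
    disc-attained α≤1 with argmin-sel (λ y → y) (norm p (B *ᵥ replicate k 1#)) norms
    -- If `min` returns its default, the all-ones vector attains it, and α ≤ 1 makes that vector
    -- admissible.
    ... | inj₁ min≡ones = replicate k 1# , All.map inj₂ (ones k) ,
      ≤-resp refl (trans (*-identityˡ _) (sym (units⇒norm₁≈k (ones k)))) (*-monoʳ-≤ (0≤fromℕ k) α≤1) ,
      ≤-reflexive (reflexive (≡.sym min≡ones))
    ... | inj₂ min∈ with x , x∈ , min≡ ← ∈-map⁻ (λ x → norm p (B *ᵥ x)) min∈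
                    with x∈′ , αk≤x ← ∈-filter⁻ (λ x → α * fromℕ k ≤? norm₁ x) {xs = colourings k} x∈ =
      x , All.map sign⇒ternary (∈-allVecs⁻ signs x∈′) , αk≤x , ≤-reflexive (reflexive (≡.sym min≡))

  -- Both minima run over the same colourings, since admissibility does not involve the matrix.
  disc-mono-≤ : ∀ p α {m m′ k} (B : Matrix m k) (C : Matrix m′ k) →
                (∀ x → norm p (B *ᵥ x) ≤ norm p (C *ᵥ x)) → disc p α B ≤ disc p α C
  disc-mono-≤ p α {k = k} B C B≤C = v≤min⁺ {xs = List.map (λ x → norm p (C *ᵥ x)) (admissible α k)}
    (≤-trans (disc≤ones p α B) (B≤C (replicate k 1#)))
    (ListAll.map⁺ (ListAll.tabulate λ {x} x∈ → ≤-trans (disc≤admissible p α B x∈) (B≤C x)))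

  disc₁-≤ : ∀ p {m k} (B : Matrix m k) {z} → All Unit z → disc p 1# B ≤ norm p (B *ᵥ z)
  disc₁-≤ p {k = k} B {z} units with z′ , z′∈ , z′≈z , units′ ← units⇒colouring units = ≤-trans
    (disc≤admissible p 1# B (∈-filter⁺ (λ x → 1# * fromℕ k ≤? norm₁ x) {xs = colourings k}
      (∈-allVecs⁺ {X = Carrier} {signs} {k} z′∈)
      (≤-reflexive (trans (*-identityˡ _) (sym (units⇒norm₁≈k units′))))))
    (norm-*ᵥ-≤ p B B z′ z λ i → dot-cong (lookup B i) (lookup B i) z′ z (Pointwise.refl refl) z′≈z)

  module _ {m k} (B : Matrix m k) (x : Vec Carrier k) where
    private
      Bounded : Carrier → Vec Carrier k → Set
      Bounded c r = abs (dot r x) ≤ c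

      rows-bounded : ∀ {m} (C : Matrix m k) → All (Bounded (norm ∞ (C *ᵥ x))) C
      rows-bounded C = All.lookup⁻ λ i →
        ≡.subst (λ y → abs y ≤ norm ∞ (C *ᵥ x)) (lookup-*ᵥ C x i) (∣vᵢ∣≤∞-norm (C *ᵥ x) i)

      ∞-norm-≤ : ∀ {m c} (C : Matrix m k) → 0# ≤ c → All (Bounded c) C → norm ∞ (C *ᵥ x) ≤ c
      ∞-norm-≤ {c = c} C 0≤c rows≤c = ∞-norm-lub (C *ᵥ x) 0≤c λ i →
        ≡.subst (λ y → abs y ≤ c) (≡.sym (lookup-*ᵥ C x i)) (All.lookup⁺ rows≤c i)

    ∞-norm-distinctRows-≤ : norm ∞ (distinctRows B *ᵥ x) ≤ norm ∞ (B *ᵥ x)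
    ∞-norm-distinctRows-≤ = ∞-norm-≤ (distinctRows B) (0≤∞-norm (B *ᵥ x))
      (All.fromList⁺ (ListAll.deduplicate⁺ (Pointwise.decidable _≟_) (All.toList⁺ (rows-bounded B))))

    -- A deleted row agrees entrywise with a kept one, so it has the same product with x. A bound on
    -- the kept rows thus covers all rows, and a maximum asks for nothing more.
    ∞-norm-distinctRows-≥ : norm ∞ (B *ᵥ x) ≤ norm ∞ (distinctRows B *ᵥ x)
    ∞-norm-distinctRows-≥ = ∞-norm-≤ B (0≤∞-norm (distinctRows B *ᵥ x))
      (All.toList⁻ (ListAll.deduplicate⁻ (Pointwise.decidable _≟_)
        (λ {r} {s} r≈s ∣r∣≤c → ≤-trans (≤-reflexive (sym (∣x∣-cong (dot-cong r s x x r≈s (Pointwise.refl refl))))) ∣r∣≤c)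
        (toList B) (All.fromList⁻ (rows-bounded (distinctRows B)))))

  module _ {m n} (A : Matrix m n) where
    -- With its converse below, this reduces both treatments of duplicates to `columns A S`, so the
    -- colouring argument never meets deleted rows.
    disc≤discOn : ∀ {p} (d : Duplicates p) α S → disc p α (columns A S) ≤ discOn d α A S
    disc≤discOn kept    α S = ≤-refl
    disc≤discOn removed α S = disc-mono-≤ ∞ α (columns A S) (distinctRows (columns A S)) (∞-norm-distinctRows-≥ (columns A S))

    discOn≤disc : ∀ {p} (d : Duplicates p) α S → discOn d α A S ≤ disc p α (columns A S)
    discOn≤disc kept    α S = ≤-refl
    discOn≤disc removed α S = disc-mono-≤ ∞ α (distinctRows (columns A S)) (columns A S) (∞-norm-distinctRows-≤ (columns A S))

    discOn-nonneg : ∀ {p} (d : Duplicates p) α S → 0# ≤ discOn d α A S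
    discOn-nonneg {p} d α S = ≤-trans (disc-nonneg p α (columns A S)) (disc≤discOn d α S)

    norm-empty : ∀ p S z → ∣ S ∣ ≡ 0 → norm p (columns A S *ᵥ z) ≤ 0#
    norm-empty p S z ∣S∣≡0 = norm-zero p (columns A S *ᵥ z) λ i →
      trans (reflexive (lookup-*ᵥ (columns A S) z i)) (dot-empty (lookup (columns A S) i) z ∣S∣≡0)

    discOn-empty : ∀ {p} (d : Duplicates p) α S → ∣ S ∣ ≡ 0 → discOn d α A S ≤ 0#
    discOn-empty {p} d α S ∣S∣≡0 =
      ≤-trans (discOn≤disc d α S) (≤-trans (disc≤ones p α (columns A S)) (norm-empty p S (replicate ∣ S ∣ 1#) ∣S∣≡0))

    herdisc-lub : ∀ {p} (d : Duplicates p) α {c} → (∀ S → discOn d α A S ≤ c) → herdisc d α A ≤ c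
    herdisc-lub d α ≤c = max≤v⁺ {xs = List.map (discOn d α A) (subsets n)} (≤c ⊥)
      (ListAll.map⁺ (ListAll.universal ≤c (subsets n)))

    module _ {p} (d : Duplicates p) (α : Carrier) where
      private
        f : Carrier → Carrier
        f = maxDiscUpTo d α A

        values : Carrier → List Carrier
        values s = List.map (discOn d α A) (List.filter (λ S → fromℕ ∣ S ∣ ≤? s) (subsets n))

      discOn≤maxDiscUpTo : ∀ {s} S → fromℕ ∣ S ∣ ≤ s → discOn d α A S ≤ f s
      discOn≤maxDiscUpTo {s} S ∣S∣≤s = v≤max⁺ (discOn d α A ⊥) (values s) (inj₂ (lose
        (∈-map⁺ (discOn d α A) (∈-filter⁺ (λ S → fromℕ ∣ S ∣ ≤? s)
          (∈-allVecs⁺ (All.lookup⁻ λ i → side∈ (lookup S i))) ∣S∣≤s))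
        ≤-refl))
        where
        side∈ : ∀ b → b ∈ inside ∷ outside ∷ []
        side∈ true  = here ≡.refl
        side∈ false = there (here ≡.refl)

      -- The bound at ⊥ is asked for separately because ⊥ is the default of `max` and counts even
      -- when s is negative.
      maxDiscUpTo-lub : ∀ {s c} → discOn d α A ⊥ ≤ c → (∀ S → fromℕ ∣ S ∣ ≤ s → discOn d α A S ≤ c) → f s ≤ c
      maxDiscUpTo-lub {s} ⊥≤c ≤c = max≤v⁺ {xs = values s} ⊥≤c (ListAll.map⁺ (ListAll.tabulate λ {S} S∈ →
        ≤c S (proj₂ (∈-filter⁻ (λ S → fromℕ ∣ S ∣ ≤? s) {xs = subsets n} S∈))))

      maxDiscUpTo-mono-≤ : ∀ {s t} → s ≤ t → f s ≤ f t
      maxDiscUpTo-mono-≤ {t = t} s≤t = maxDiscUpTo-lub (⊥≤max (discOn d α A ⊥) (values t)) λ S ∣S∣≤s →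
        discOn≤maxDiscUpTo S (≤-trans ∣S∣≤s s≤t)

      maxDiscUpTo-nonneg : ∀ s → 0# ≤ f s
      maxDiscUpTo-nonneg s = ≤-trans (discOn-nonneg d α ⊥) (⊥≤max (discOn d α A ⊥) (values s))

      maxDiscUpTo-<1 : ∀ {s} → s < 1# → f s ≈ 0#
      maxDiscUpTo-<1 {s} s<1 = ≤-antisym
        (maxDiscUpTo-lub (discOn-empty d α ⊥ (∣⊥∣≡0 n)) λ S ∣S∣≤s → discOn-empty d α S (fromℕ<1 (≤-<-trans ∣S∣≤s s<1)))
        (maxDiscUpTo-nonneg s)

  -- The columns S₁ left uncoloured by x may be coloured afterwards by any z₁.
  recolour : ∀ {n} (S : Subset n) {x : Vec Carrier ∣ S ∣} → All Ternary x →
             Σ[ S₁ ∈ Subset n ] fromℕ ∣ S ∣ ≈ fromℕ ∣ S₁ ∣ + norm₁ x ×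
               (∀ {z₁} → All Unit z₁ → ∃ λ z → All Unit z ×
                 ∀ r → dot (select S r) z ≈ dot (select S r) x + dot (select S₁ r) z₁)
  recolour [] [] = [] , sym (+-identityʳ 0#) , λ { [] → [] , [] , λ { [] → sym (+-identityʳ 0#) } }
  recolour (outside ∷ S) cs with S₁ , count , colour ← recolour S cs =
    outside ∷ S₁ , count , λ units → let z , us , dots = colour units in z , us , λ { (_ ∷ r) → dots r }
  -- An entry 0 adds nothing to `norm₁ x`, so its column goes to S₁ and takes its colour w from z₁.
  -- A unit entry adds 1 and is final.
  recolour (inside ∷ S) {c ∷ x} (inj₁ c≈0 ∷ cs) with S₁ , count , colour ← recolour S cs =
    inside ∷ S₁ ,
    trans (+-congˡ count) (trans (solve 2 (λ a b → :1 :+ (a :+ b) := :1 :+ a :+ (:0 :+ b)) refl (fromℕ ∣ S₁ ∣) (norm₁ x))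
      (+-congˡ (+-congʳ (sym (trans (∣x∣-cong c≈0) (nonneg⇒∣x∣≈x ≤-refl)))))) ,
    λ { {w ∷ _} (u ∷ units) → let z , us , dots = colour units in w ∷ z , u ∷ us ,
      λ { (a ∷ r) → trans (+-congˡ (dots r))
        (trans (solve 4 (λ a w X Z → a :* w :+ (X :+ Z) := a :* :0 :+ X :+ (a :* w :+ Z)) refl a w _ _)
          (+-congʳ (+-congʳ (*-congˡ (sym c≈0))))) } }
  recolour (inside ∷ S) {c ∷ x} (inj₂ u ∷ cs) with S₁ , count , colour ← recolour S cs =
    outside ∷ S₁ ,
    trans (+-congˡ count) (trans (solve 2 (λ a b → :1 :+ (a :+ b) := a :+ (:1 :+ b)) refl (fromℕ ∣ S₁ ∣) (norm₁ x))
      (+-congˡ (+-congʳ (sym (unit⇒∣c∣≈1 u))))) ,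
    λ units → let z , us , dots = colour units in c ∷ z , u ∷ us ,
      λ { (a ∷ r) → trans (+-congˡ (dots r)) (sym (+-assoc _ _ _)) }

  -- ∣ ⊤ ∣ does not compute to n, so a colouring of `columns A ⊤` has to be carried over to A.
  extend-⊤ : ∀ {n} {z : Vec Carrier ∣ ⊤ {n} ∣} → All Unit z →
             Σ[ z′ ∈ Vec Carrier n ] All Unit z′ × ∀ r → dot r z′ ≈ dot (select ⊤ r) z
  extend-⊤ {zero}  []                = [] , [] , λ { [] → refl }
  extend-⊤ {suc n} {w ∷ _} (u ∷ units) =
    let z′ , us , dots = extend-⊤ {n} units in w ∷ z′ , u ∷ us , λ { (a ∷ r) → +-congˡ (dots r) }

  partialSum-mono-≤ : ∀ {a b} → (∀ i → a i ≤ b i) → ∀ n → partialSum a n ≤ partialSum b n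
  partialSum-mono-≤ a≤b zero    = ≤-refl
  partialSum-mono-≤ a≤b (suc n) = +-mono-≤ (partialSum-mono-≤ a≤b n) (a≤b n)

  partialSum-suc : ∀ a n → partialSum a (suc n) ≈ a 0 + partialSum (λ i → a (suc i)) n
  partialSum-suc a zero    = +-comm _ _
  partialSum-suc a (suc n) = trans (+-congʳ (partialSum-suc a n)) (+-assoc _ _ _)

  eventually-zero⇒HasSum : ∀ a N → (∀ i → N ℕ.≤ i → a i ≈ 0#) → HasSum a (partialSum a N)
  eventually-zero⇒HasSum a N a≈0 ε 0<ε = N , λ n N≤n → ≤-<-trans (≤-reflexive (
      trans (∣x∣-cong (trans (+-congʳ (constant n N≤n)) (-‿inverseʳ _))) (nonneg⇒∣x∣≈x ≤-refl))) 0<ε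
    where
    constant : ∀ n → N ℕ.≤ n → partialSum a n ≈ partialSum a N
    constant n N≤n with ℕ.m≤n⇒m<n∨m≡n N≤n
    ... | inj₂ ≡.refl = refl
    constant (suc n) _ | inj₁ N<1+n =
      trans (+-cong (constant n (ℕ.≤-pred N<1+n)) (a≈0 n (ℕ.≤-pred N<1+n))) (+-identityʳ _)

  -- Iterated partial colouring and the series

  module Iteration {m n} (A : Matrix m n) {α : Carrier} (0<α : 0# < α) (α<1 : α < 1#)
                   {p : Exponent} (d : Duplicates p) where
    private
      f : Carrier → Carrier
      f = maxDiscUpTo d α A
      β : Carrier
      β = 1# - α
      0≤β : 0# ≤ β
      0≤β = x≤y⇒0≤y-x (<⇒≤ α<1)
      β≤1 : β ≤ 1#
      β≤1 = ≤-by α (<⇒≤ 0<α) (solve 1 (λ α → :1 :- α :+ α := :1) refl α)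
      β<1 : β < 1#
      β<1 = ≰⇒> λ 1≤β → <⇒≱ 0<α (≤-resp
        (solve 1 (λ α → :1 :- (:1 :- α) := α) refl α) (-‿inverseʳ β) (+-monoˡ-≤ (- β) 1≤β))

      remaining≤ : ∀ {k l x s} → k ≈ l + x → α * k ≤ x → k ≤ s → l ≤ β * s
      remaining≤ {k} {l} {x} {s} k≈l+x αk≤x k≤s = begin
        l             ≈⟨ solve 2 (λ l x → l := l :+ x :- x) refl l x ⟩
        l + x - x     ≈⟨ +-congʳ k≈l+x ⟨
        k - x         ≤⟨ +-monoʳ-≤ k (neg-antimono-≤ αk≤x) ⟩
        k - α * k     ≈⟨ solve 2 (λ k α → k :- α :* k := (:1 :- α) :* k) refl k α ⟩
        β * k         ≤⟨ *-monoˡ-≤ 0≤β k≤s ⟩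
        β * s         ∎
        where open ≤-Reasoning

      -- The index shift of the induction: the first term pays for x, and the series of the
      -- remaining set, started at β s, is the tail of the series started at s.
      combine : ∀ N {s} (S S₁ : Subset n) x z₁ z →
                (∀ r → dot (select S r) z ≈ dot (select S r) x + dot (select S₁ r) z₁) →
                fromℕ ∣ S ∣ ≤ s →
                norm p (columns A S *ᵥ x) ≤ disc p α (columns A S) →
                norm p (columns A S₁ *ᵥ z₁) ≤ partialSum (λ i → f (β ^ i * (β * s))) N →
                norm p (columns A S *ᵥ z) ≤ partialSum (λ i → f (β ^ i * s)) (suc N)
      combine N {s} S S₁ x z₁ z dots ∣S∣≤s Bx≤disc Bz₁≤ = begin
        norm p (columns A S *ᵥ z)
          ≤⟨ norm-cong-≤ p (columns A S *ᵥ z) (zipWith _+_ (columns A S *ᵥ x) (columns A S₁ *ᵥ z₁)) rows ⟩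
        norm p (zipWith _+_ (columns A S *ᵥ x) (columns A S₁ *ᵥ z₁))
          ≤⟨ norm-triangle p (columns A S *ᵥ x) (columns A S₁ *ᵥ z₁) ⟩
        norm p (columns A S *ᵥ x) + norm p (columns A S₁ *ᵥ z₁)
          ≤⟨ +-mono-≤ (≤-trans Bx≤disc (≤-trans (disc≤discOn A d α S)
               (discOn≤maxDiscUpTo A d α S (≤-trans ∣S∣≤s (≤-reflexive (sym (*-identityˡ s))))))) Bz₁≤ ⟩
        f (1# * s) + partialSum (λ i → f (β ^ i * (β * s))) N
          -- The arguments of f on the two sides are equal only up to ≈; its monotonicity serves as
          -- congruence.
          ≤⟨ +-monoʳ-≤ (f (1# * s)) (partialSum-mono-≤ (λ i → maxDiscUpTo-mono-≤ A d α
               (≤-reflexive (trans (sym (*-assoc _ _ _)) (*-congʳ (*-comm _ _))))) N) ⟩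
        f (1# * s) + partialSum (λ i → f (β ^ suc i * s)) N
          ≈⟨ partialSum-suc (λ i → f (β ^ i * s)) N ⟨
        partialSum (λ i → f (β ^ i * s)) (suc N) ∎
        where
        open ≤-Reasoning
        row : ∀ {S : Subset n} (z : Vec Carrier ∣ S ∣) i → lookup (columns A S *ᵥ z) i ≡ dot (select S (lookup A i)) z
        row {S} z i = ≡.trans (lookup-*ᵥ (columns A S) z i) (≡.cong (λ r → dot r z) (Vec.lookup-map i (select S) A))
        rows : ∀ i → lookup (columns A S *ᵥ z) i ≈ lookup (zipWith _+_ (columns A S *ᵥ x) (columns A S₁ *ᵥ z₁)) i
        rows i rewrite Vec.lookup-zipWith _+_ i (columns A S *ᵥ x) (columns A S₁ *ᵥ z₁)
                     | row {S} z i | row {S} x i | row {S₁} z₁ i = dots (lookup A i)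

    -- N bounds the number of rounds. Each round replaces s by β s, so the last hypothesis passes on
    -- with N - 1; when N reaches 0 it says |S| ≤ s < 1, which leaves no column to colour.
    fullColouring : ∀ N {s} S → fromℕ ∣ S ∣ ≤ s → β ^ N * s < 1# →
      ∃ λ z → All Unit z × norm p (columns A S *ᵥ z) ≤ partialSum (λ i → f (β ^ i * s)) N
    fullColouring zero {s} S ∣S∣≤s s<1 =
      replicate ∣ S ∣ 1# , ones (∣ S ∣) , norm-empty A p S (replicate _ 1#)
        (fromℕ<1 (≤-<-trans ∣S∣≤s (≤-<-trans (≤-reflexive (sym (*-identityˡ s))) s<1)))
    fullColouring (suc N) {s} S ∣S∣≤s βᴺ⁺¹s<1 =
      let x , ternary , α∣S∣≤x , Bx≤disc = disc-attained p α (columns A S) (<⇒≤ α<1)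
          S₁ , count , colour = recolour S ternary
          z₁ , units₁ , Bz₁≤ = fullColouring N {β * s} S₁ (remaining≤ count α∣S∣≤x ∣S∣≤s)
            (≤-<-trans (≤-reflexive (trans (sym (*-assoc _ _ _)) (*-congʳ (*-comm _ _)))) βᴺ⁺¹s<1)
          z , units , dots = colour units₁
      in z , units , combine N S S₁ x z₁ z dots ∣S∣≤s Bx≤disc Bz₁≤

    -- N is chosen at least n / α so that n ≤ β + N α. Bernoulli's inequality with u = β and v = α,
    -- where u + v = 1, gives β ^ N (β + N α) ≤ β. Strictness comes from β < 1, and larger exponents
    -- follow from β ≤ 1.
    geometric-<1 : ∃ λ N → ∀ i → N ℕ.≤ i → β ^ i * fromℕ n < 1#
    geometric-<1 with N , n/α≤N ← archimedean (fromℕ n * α ⁻¹) = N , λ i N≤i →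
        ≤-<-trans (≤-trans (*-monoʳ-≤ (0≤fromℕ n) (^-antimonoʳ-≤ 0≤β β≤1 N≤i)) (βᴺn≤β N n/α≤N)) β<1
      where
      open ≤-Reasoning
      βᴺn≤β : ∀ N → fromℕ n * α ⁻¹ ≤ fromℕ N → β ^ N * fromℕ n ≤ β
      βᴺn≤β N n/α≤N = begin
        β ^ N * fromℕ n               ≤⟨ *-monoˡ-≤ (^-nonneg N 0≤β) n≤β+Nα ⟩
        β ^ N * (β + fromℕ N * α)     ≤⟨ uⁿ[u+nv]≤u[u+v]ⁿ N 0≤β (<⇒≤ 0<α) ⟩
        β * (β + α) ^ N               ≈⟨ *-congˡ (^-congˡ N (solve 1 (λ α → :1 :- α :+ α := :1) refl α)) ⟩
        β * 1# ^ N                    ≈⟨ trans (*-congˡ (1^n≈1 N)) (*-identityʳ β) ⟩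
        β                             ∎
        where
        n≤β+Nα : fromℕ n ≤ β + fromℕ N * α
        n≤β+Nα = begin
          fromℕ n                     ≈⟨ *-identityʳ _ ⟨
          fromℕ n * 1#                ≈⟨ *-congˡ (x⁻¹*x≈1 0<α) ⟨
          fromℕ n * (α ⁻¹ * α)        ≈⟨ *-assoc _ _ _ ⟨
          fromℕ n * α ⁻¹ * α          ≤⟨ *-monoʳ-≤ (<⇒≤ 0<α) n/α≤N ⟩
          fromℕ N * α                 ≤⟨ ≤-by β 0≤β (+-comm _ _) ⟩
          β + fromℕ N * α             ∎

    private
      a : ℕ → Carrier
      a i = f (β ^ i * fromℕ n)

    disc-columns≤ : ∀ N → β ^ N * fromℕ n < 1# → ∀ S → disc p 1# (columns A S) ≤ partialSum a N
    disc-columns≤ N small S =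
      let z , units , ≤s = fullColouring N S (fromℕ-mono-≤ (∣p∣≤n S)) small
      in ≤-trans (disc₁-≤ p (columns A S) {z} units) ≤s

    disc≤ : ∀ N → β ^ N * fromℕ n < 1# → disc p 1# A ≤ partialSum a N
    disc≤ N small =
      let z , units , ≤s = fullColouring N (⊤ {n}) (fromℕ-mono-≤ (∣p∣≤n (⊤ {n}))) small
          z′ , units′ , dots = extend-⊤ {n} {z} units
      in ≤-trans (disc₁-≤ p A {z′} units′) (≤-trans (norm-*ᵥ-≤ p A (columns A (⊤ {n})) z′ z λ i →
           trans (dots (lookup A i)) (reflexive (≡.cong (λ r → dot r z) (≡.sym (Vec.lookup-map i (select ⊤) A))))) ≤s)

    series-bounds : Σ[ s ∈ Carrier ] HasSum (λ i → f (β ^ i * fromℕ n)) s × disc p 1# A ≤ s × herdisc d 1# A ≤ s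
    series-bounds =
      let N , small = geometric-<1
      in partialSum a N ,
         eventually-zero⇒HasSum a N (λ i N≤i → maxDiscUpTo-<1 A d α (small i N≤i)) ,
         disc≤ N (small N ℕ.≤-refl) ,
         herdisc-lub A d 1# λ S → ≤-trans (discOn≤disc A d 1# S) (disc-columns≤ N (small N ℕ.≤-refl) S)

lemma5 : (ℝ : RealNumbers) → let open Discrepancy ℝ in
    ∀ {m n : ℕ} (A : Matrix m n) (α : Carrier) → 0# < α → α < 1# →
    (p : Exponent) (d : Duplicates p) →
    let f : Carrier → Carrier
        f = maxDiscUpTo d α A
    in Σ[ s ∈ Carrier ]
         HasSum (λ i → f ((1# - α) ^ i * fromℕ n)) s ×
         disc p 1# A ≤ s ×
         herdisc d 1# A ≤ s
lemma5 ℝ A α 0<α α<1 p d = PartialColourings.Iteration.series-bounds ℝ A 0<α α<1 d
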